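{- If $G$ is a finite simple undirected AT-free graph, then $\mathrm{cub}(G) \le \mathrm{box}(G)\,(\lceil \log_2 \psi(G)\rceil + 2) \le \chi(G)\,(\lceil \log_2 \psi(G)\rceil + 2)$, where $\chi(G)$ is the chromatic number of $G$.
   Context: $G$ is AT-free if it has no asteroidal triple (independent set of three vertices such that between each pair there is a path avoiding the neighbourhood of the third). $\mathrm{box}(G)$ (resp. $\mathrm{cub}(G)$) is the minimum $k$ such that $G$ is the intersection graph of axis-parallel boxes (resp. unit cubes) in $\mathbb{R}^k$, equivalently the minimum $k$ such that $G$ is the edge-intersection of $k$ interval graphs (resp. unit interval graphs) on $V(G)$. $S(k)$ denotes the star $K_{1,k}$; the claw number $\psi(G)$ is the largest positive integer $k$ such that $S(k)$ is an induced subgraph of $G$. -}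

module Defs where

open import Level using (0ℓ)
open import Data.Nat using (ℕ; _≤_; _+_; _*_)
open import Data.Nat.Logarithm using (⌈log₂_⌉)
open import Data.Fin using (Fin)
open import Data.Rational using (ℚ; 1ℚ) renaming (_≤_ to _≤ℚ_; _+_ to _+ℚ_)
open import Data.Product using (Σ; ∃; _×_)
open import Data.Sum using (_⊎_)
open import Relation.Nullary using (¬_)
open import Relation.Binary.PropositionalEquality using (_≡_; _≢_)
open import Relation.Binary using (Decidable)
open import Function using (_⇔_; Injective)

record Graph (n : ℕ) : Set₁ where
  field
    Adj     : Fin n → Fin n → Set
    adj?    : Decidable Adj
    sym     : ∀ {u v} → Adj u v → Adj v u
    irrefl  : ∀ {u} → ¬ Adj u u
open Graph public

module _ {n : ℕ} (G : Graph n) where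

  InClosedNbhd : Fin n → Fin n → Set
  InClosedNbhd z v = (v ≡ z) ⊎ Adj G z v

  -- walks (equivalently: paths) from x to y all of whose vertices avoid N[z]
  data PathAvoiding (z : Fin n) : Fin n → Fin n → Set where
    stop : ∀ {x} → ¬ InClosedNbhd z x → PathAvoiding z x x
    step : ∀ {x y w} → ¬ InClosedNbhd z x → Adj G x y →
           PathAvoiding z y w → PathAvoiding z x w

  IsAsteroidalTriple : Fin n → Fin n → Fin n → Set
  IsAsteroidalTriple x y z =
    x ≢ y × y ≢ z × x ≢ z ×
    ¬ Adj G x y × ¬ Adj G y z × ¬ Adj G x z ×
    PathAvoiding z x y × PathAvoiding x y z × PathAvoiding y x z

  ATFree : Set
  ATFree = ∀ x y z → ¬ IsAsteroidalTriple x y z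

  record BoxRep (k : ℕ) : Set where
    field
      lo hi   : Fin n → Fin k → ℚ
      lo≤hi   : ∀ v i → lo v i ≤ℚ hi v i
      correct : ∀ u v → u ≢ v →
                (Adj G u v ⇔ (∀ i → lo u i ≤ℚ hi v i × lo v i ≤ℚ hi u i))

  record CubeRep (k : ℕ) : Set where
    field
      lo      : Fin n → Fin k → ℚ
      correct : ∀ u v → u ≢ v →
                (Adj G u v ⇔ (∀ i → lo u i ≤ℚ (lo v i +ℚ 1ℚ) × lo v i ≤ℚ (lo u i +ℚ 1ℚ)))

  IsBoxicity : ℕ → Set
  IsBoxicity b = BoxRep b × (∀ k → BoxRep k → b ≤ k)

  CubicityAtMost : ℕ → Set
  CubicityAtMost m = ∃ λ k → k ≤ m × CubeRep k

  ProperColouring : ℕ → Set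
  ProperColouring q = Σ (Fin n → Fin q) λ f → ∀ u v → Adj G u v → f u ≢ f v

  IsChromaticNumber : ℕ → Set
  IsChromaticNumber c = ProperColouring c × (∀ q → ProperColouring q → c ≤ q)

  InducedStar : ℕ → Set
  InducedStar k = Σ (Fin n) λ c → Σ (Fin k → Fin n) λ leaf →
    Injective _≡_ _≡_ leaf ×
    (∀ i → Adj G c (leaf i)) ×
    (∀ i j → ¬ Adj G (leaf i) (leaf j))

  IsClawNumber : ℕ → Set
  IsClawNumber p = 1 ≤ p × InducedStar p × (∀ k → 1 ≤ k → InducedStar k → k ≤ p)

{-# OPTIONS --safe #-}
-- Box coordinate by box coordinate, the interval supergraph I of G is replaced by
-- a chordal graph H, G ⊆ H ⊆ I, that no clique sum can make smaller.  In such an H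
-- every component left after deleting a clique is attached in G to as much of that
-- clique as in H; therefore an asteroidal triple of maximal cliques of H would give
-- an asteroidal triple of G, the maximal cliques can be arranged in a path, and H is
-- an interval graph.  Stabbing its intervals greedily from the left gives every
-- vertex a rank that increases along disjoint intervals, and edges of G join ranks
-- at most ψ apart: a neighbourhood spanning m stabbing points contains m independent
-- G-neighbours, again because G is AT-free.  If ψ ≤ 2ᵏ, the k lowest binary digits
-- of the rank, together with its quotient by 2ᵏ used with two different parities,
-- yield k + 2 unit interval graphs that separate all disjoint pairs of intervals.
--
-- For box ≤ χ, enlarge each colour class to a maximal independent set.  AT-freeness
-- arranges it on a line so that every vertex sees a consecutive part of it, and the
-- resulting interval graph separates each of its members from all non-neighbours.
module Submission where

open import Defs
open import Data.Bool using (true; if_then_else_)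
open import Data.Empty using (⊥; ⊥-elim)
open import Data.Fin using (Fin; zero; suc; toℕ; fromℕ<; remQuot; combine)
open import Data.Fin.Properties using (_≟_; all?; any?; <-cmp; toℕ-injective; toℕ<n; toℕ-fromℕ<; remQuot-combine)
open import Data.Fin.Subset as Subset using (Subset; _∪_; ⁅_⁆)
open import Data.Fin.Subset.Properties as Subset using (anySubset?; x∈p∪q⁻; p⊆p∪q; q⊆p∪q; x∈⁅x⁆; x∈⁅y⁆⇒x≡y)
open import Data.Integer as ℤ using (+≤+)
import Data.Integer.Properties as ℤ
open import Data.List using (List; []; _∷_; _++_; allFin; length; filter; reverse; lookup; cartesianProduct)
open import Data.List.Membership.Propositional using (_∈_; lose)
open import Data.List.Membership.Propositional.Properties using (∈-allFin; ∈-filter⁺; ∈-filter⁻; ∈-cartesianProduct⁺; ∈-++⁺ˡ; ∈-++⁺ʳ; ∈-++⁻; ∈-lookup)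
open import Data.List.Properties using (filter-notAll; length-filter; unfold-reverse)
open import Data.List.Relation.Unary.All as All using (All; []; _∷_)
open import Data.List.Relation.Unary.AllPairs as AllPairs using (AllPairs; []; _∷_)
open import Data.List.Relation.Unary.AllPairs.Properties using () renaming (++⁺ to allPairs-++)
open import Data.List.Relation.Unary.Any using (here; there; index)
open import Data.List.Relation.Unary.Any.Properties using (reverse⁺; reverse⁻; lookup-index)
open import Data.Nat using (ℕ; zero; suc; _+_; _*_; _^_; _≤_; _<_; s≤s; z≤n; _≤?_; _<?_; ⌊_/2⌋; ⌈_/2⌉)
open import Data.Nat.Induction using (<-wellFounded)
open import Data.Nat.Logarithm using (⌈log₂_⌉)
open import Data.Nat.Logarithm.Core using (⌈log2⌉)
import Data.Nat.Properties as ℕ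
open import Data.Nat.Properties using (≤-trans; ≤-refl; ≤-reflexive; ≤-total; ≤-pred; <-≤-trans; ≤-<-trans; <⇒≤; ≰⇒>; ≮⇒≥; m≤n⇒m<n∨m≡n; n≤1+n; m≤m+n; m≤n+m; +-monoʳ-≤; +-monoʳ-<)
open import Data.Product as Product using (∃; ∃₂; _×_; _,_; proj₁; proj₂)
open import Data.Product.Properties using (≡-dec)
open import Data.Rational using (ℚ; 1ℚ; toℚᵘ; fromℚᵘ) renaming (_≤_ to _≤ℚ_; _<_ to _<ℚ_; _+_ to _+ℚ_)
import Data.Rational.Properties as ℚ
open import Data.Rational.Unnormalised as ℚᵘ using (mkℚᵘ; *≤*; *≡*)
import Data.Rational.Unnormalised.Properties as ℚᵘ
open import Data.Sum as Sum using (_⊎_; inj₁; inj₂)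
open import Data.Vec using (tabulate)
open import Data.Vec.Properties using (lookup∘tabulate; []=⇒lookup; lookup⇒[]=)
open import Function using (_∘_; mk⇔; Equivalence)
open import Induction.WellFounded using (Acc; acc)
open import Relation.Binary using (DecidableEquality; tri<; tri≈; tri>)
open import Relation.Binary.PropositionalEquality using (_≡_; _≢_; refl; subst; subst₂; trans; cong; cong₂) renaming (sym to ≡-sym)
open import Relation.Nullary using (¬_; Dec; yes; no; ¬?; does)
open import Relation.Nullary.Decidable using (_×-dec_; _⊎-dec_; _→-dec_; map′; decidable-stable; dec-true)

-- Walks inside a vertex set

data Walk {A : Set} (E : A → A → Set) (U : A → Set) : A → A → Set where
  stay : ∀ {x} → U x → Walk E U x x
  move : ∀ {x y z} → U x → E x y → Walk E U y z → Walk E U x z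

module _ {A : Set} {E : A → A → Set} where

  private variable
    U V P : A → Set
    x y z : A

  walk-source : Walk E U x y → U x
  walk-source (stay u)     = u
  walk-source (move u _ _) = u

  walk-target : Walk E U x y → U y
  walk-target (stay u)     = u
  walk-target (move _ _ w) = walk-target w

  walk-++ : Walk E U x y → Walk E U y z → Walk E U x z
  walk-++ (stay _)     w′ = w′
  walk-++ (move u e w) w′ = move u e (walk-++ w w′)

  walk-∷ʳ : Walk E U x y → E y z → U z → Walk E U x z
  walk-∷ʳ w e u = walk-++ w (move (walk-target w) e (stay u))

  walk-reverse : (∀ {u v} → E u v → E v u) → Walk E U x y → Walk E U y x
  walk-reverse sym (stay u)     = stay u
  walk-reverse sym (move u e w) = walk-∷ʳ (walk-reverse sym w) (sym e) u

  walk-map : (∀ {v} → U v → V v) → Walk E U x y → Walk E V x y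
  walk-map f (stay u)     = stay (f u)
  walk-map f (move u e w) = move (f u) e (walk-map f w)

  -- Each vertex of a walk is reached by the initial segment ending there. This is how a walk that
  -- avoids something becomes a walk inside one component.
  walk-within-component : Walk E U x y → Walk E (Walk E U x) x y
  walk-within-component w = go (stay (walk-source w)) w
    where
    go : ∀ {x y z} → Walk E U x y → Walk E U y z → Walk E (Walk E U x) y z
    go w₀ (stay _)     = stay w₀
    go w₀ (move u e w) = move w₀ e (go (walk-∷ʳ w₀ e (walk-source w)) w)

  walk-closed : (∀ {v w} → P v → E v w → U w → P w) → P x → Walk E U x y → P y
  walk-closed cl p (stay _)     = p
  walk-closed cl p (move _ e w) = walk-closed cl (cl p e (walk-source w)) w

  module _ (P? : ∀ v → Dec (P v)) where

    walk-avoids-or-meets : Walk E U x y →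
      Walk E (λ v → U v × ¬ P v) x y ⊎ ∃ λ z → P z × Walk E U x z
    walk-avoids-or-meets {x = x} w with P? x
    walk-avoids-or-meets w            | yes p = inj₂ (_ , p , stay (walk-source w))
    walk-avoids-or-meets (stay u)     | no ¬p = inj₁ (stay (u , ¬p))
    walk-avoids-or-meets (move u e w) | no ¬p with walk-avoids-or-meets w
    ... | inj₁ w′           = inj₁ (move (u , ¬p) e w′)
    ... | inj₂ (z , p , w′) = inj₂ (z , p , move u e w′)

    -- The walk is cut at its first vertex satisfying `P`. Any vertex with `P` that chordality later
    -- finds on it can then only be its end.
    walk-until : Walk E U x y → P y →
      ∃ λ z → P z × Walk E (λ v → U v × (P v → v ≡ z)) x z
    walk-until {x = x} w py with P? x
    walk-until w            py | yes p = _ , p , stay (walk-source w , λ _ → refl)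
    walk-until (stay u)     py | no ¬p = _ , py , stay (u , λ _ → refl)
    walk-until (move u e w) py | no ¬p with walk-until w py
    ... | z , pz , w′ = z , pz , move (u , λ p → ⊥-elim (¬p p)) e w′

-- Floyd–Warshall: chains of E-steps whose interior vertices come from a list.
module _ {A : Set} (E : A → A → Set) where

  Via : List A → A → A → Set
  Via []       x y = E x y
  Via (z ∷ zs) x y = Via zs x y ⊎ (Via zs x z × Via zs z y)

  via? : (∀ x y → Dec (E x y)) → ∀ zs x y → Dec (Via zs x y)
  via? E? []       x y = E? x y
  via? E? (z ∷ zs) x y = via? E? zs x y ⊎-dec (via? E? zs x z ×-dec via? E? zs z y)

  edge⇒via : ∀ zs {x y} → E x y → Via zs x y
  edge⇒via []       e = e
  edge⇒via (_ ∷ zs) e = inj₁ (edge⇒via zs e)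

  via-trans : ∀ zs {x y z} → y ∈ zs → Via zs x y → Via zs y z → Via zs x z
  via-trans (_ ∷ zs) (here refl) p q = inj₂ (to p , from q)
    where
    to : ∀ {x y} → Via (y ∷ zs) x y → Via zs x y
    to (inj₁ p)       = p
    to (inj₂ (p , _)) = p
    from : ∀ {x y} → Via (x ∷ zs) x y → Via zs x y
    from (inj₁ p)       = p
    from (inj₂ (_ , p)) = p
  via-trans (_ ∷ zs) (there i) (inj₁ p)        (inj₁ q)        = inj₁ (via-trans zs i p q)
  via-trans (_ ∷ zs) (there i) (inj₁ p)        (inj₂ (q , q′)) = inj₂ (via-trans zs i p q , q′)
  via-trans (_ ∷ zs) (there i) (inj₂ (p , p′)) (inj₁ q)        = inj₂ (p , via-trans zs i p′ q)
  -- Both chains pass the head of the list; the detour between the two visits, which contains `y`,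
  -- is cut out.
  via-trans (_ ∷ zs) (there i) (inj₂ (p , p′)) (inj₂ (q , q′)) = inj₂ (p , q′)

module _ {n : ℕ} {E : Fin n → Fin n → Set} {U : Fin n → Set} where

  private
    -- `Via` puts no condition on vertices, so each step records `U` at both ends; the equality case
    -- encodes one-vertex walks.
    Step : Fin n → Fin n → Set
    Step x y = U x × U y × (x ≡ y ⊎ E x y)

    via⇒walk : ∀ zs {x y} → Via Step zs x y → Walk E U x y
    via⇒walk []       (u , _ , inj₁ refl) = stay u
    via⇒walk []       (u , v , inj₂ e)    = move u e (stay v)
    via⇒walk (_ ∷ zs) (inj₁ p)            = via⇒walk zs p
    via⇒walk (_ ∷ zs) (inj₂ (p , q))      = walk-++ (via⇒walk zs p) (via⇒walk zs q)

    walk⇒via : ∀ {x y} → Walk E U x y → Via Step (allFin n) x y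
    walk⇒via (stay u)         = edge⇒via Step (allFin n) (u , u , inj₁ refl)
    walk⇒via (move {y = y} u e w) =
      via-trans Step (allFin n) (∈-allFin y)
        (edge⇒via Step (allFin n) (u , walk-source w , inj₂ e)) (walk⇒via w)

  walk? : (∀ x y → Dec (E x y)) → (∀ x → Dec (U x)) → ∀ x y → Dec (Walk E U x y)
  walk? E? U? x y = map′ (via⇒walk (allFin n)) walk⇒via
    (via? Step (λ a b → U? a ×-dec U? b ×-dec ((a ≟ b) ⊎-dec E? a b)) (allFin n) x y)

-- Linear orders from asteroidal-free connectivity

module _ {A : Set} {R : A → A → Set} where

  allPairs-reverse : ∀ {xs} → AllPairs R xs → AllPairs (λ a b → R b a) (reverse xs)
  allPairs-reverse []                    = []
  allPairs-reverse {x ∷ xs} (px ∷ pxs) = subst (AllPairs _) (≡-sym (unfold-reverse x xs))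
    (allPairs-++ (allPairs-reverse pxs) ([] ∷ [])
      (All.tabulate (λ a∈ → All.lookup px (reverse⁻ a∈) ∷ [])))

  allPairs-lookup : ∀ {xs} → AllPairs R xs → ∀ {i j} → toℕ i < toℕ j → R (lookup xs i) (lookup xs j)
  allPairs-lookup (px ∷ _)   {zero}  {suc j} _         = All.lookup px (∈-lookup j)
  allPairs-lookup (_ ∷ pxs)  {suc i} {suc j} (s≤s i<j) = allPairs-lookup pxs i<j

  allPairs-tabulate : ∀ xs → (∀ {a b} → a ∈ xs → b ∈ xs → R a b) → AllPairs R xs
  allPairs-tabulate []       r = []
  allPairs-tabulate (x ∷ xs) r =
    All.tabulate (λ b∈ → r (here refl) (there b∈)) ∷
    allPairs-tabulate xs (λ a∈ b∈ → r (there a∈) (there b∈))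

  allPairs-map-∈ : ∀ {S : A → A → Set} {xs} →
    (∀ {a b} → a ∈ xs → b ∈ xs → R a b → S a b) → AllPairs R xs → AllPairs S xs
  allPairs-map-∈ f []         = []
  allPairs-map-∈ f (px ∷ pxs) =
    All.tabulate (λ b∈ → f (here refl) (there b∈) (All.lookup px b∈)) ∷
    allPairs-map-∈ (λ a∈ b∈ → f (there a∈) (there b∈)) pxs

module _ {A : Set} {_≼_ : A → A → Set} (_≼?_ : ∀ a b → Dec (a ≼ b))
         (≼-refl : ∀ {a} → a ≼ a) (≼-trans : ∀ {a b c} → a ≼ b → b ≼ c → a ≼ c) where

  maximal-∈ : ∀ x xs → ∃ λ e → e ∈ x ∷ xs × (∀ {b} → b ∈ x ∷ xs → e ≼ b → b ≼ e)
  maximal-∈ x []       = x , here refl , λ { (here refl) _ → ≼-refl }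
  maximal-∈ x (y ∷ xs) with maximal-∈ y xs
  ... | e , e∈ , max with e ≼? x
  ... | yes e≼x = x , here refl , λ
        { (here refl) _  → ≼-refl
        ; (there b∈) x≼b → ≼-trans (max b∈ (≼-trans e≼x x≼b)) e≼x }
  ... | no e⋠x = e , there e∈ , λ
        { (here refl) e≼x → ⊥-elim (e⋠x e≼x)
        ; (there b∈)      → max b∈ }

-- R b a c reads "a and c are connected when (the neighbourhood of) b is removed".
record AsteroidalFree {A : Set} (R : A → A → A → Set) : Set where
  field
    connected?    : ∀ b a c → Dec (R b a c)
    symmetric     : ∀ {b a c} → R b a c → R b c a
    transitive    : ∀ {b a c d} → R b a c → R b c d → R b a d
    removed       : ∀ {a c} → ¬ R a a c
    -- Either the connection off `a` avoids `b` as well, or the part of it up to where it meets `b`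
    -- connects `e` to `b`.
    through       : ∀ {a c e} b → R a e c → R b e c ⊎ R a e b
    no-asteroidal : ∀ {a b c} → R a b c → R b a c → R c a b → ⊥

module LinearOrder {A : Set} (_≟_ : DecidableEquality A) {R : A → A → A → Set}
                   (AF : AsteroidalFree R) where
  open AsteroidalFree AF

  -- `b` separates `a` from `c`. For fixed `a` this is a preorder on `b` and `c`, and it serves as a
  -- comparison of distances from `a`.
  Between : A → A → A → Set
  Between a b c = ¬ R b a c

  between? : ∀ a b c → Dec (Between a b c)
  between? a b c = ¬? (connected? b a c)

  ¬between⇒R : ∀ {a b c} → ¬ Between a b c → R b a c
  ¬between⇒R = decidable-stable (connected? _ _ _)

  between-refl : ∀ {e a} → Between e a a
  between-refl r = removed (symmetric r)

  between-trans : ∀ {e a b c} → Between e a b → Between e b c → Between e a c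
  between-trans {b = b} eab ebc r with through b r
  ... | inj₁ r′ = ebc r′
  ... | inj₂ r′ = eab r′

  -- Off `b`, the elements `e` and `a` are connected, so what `b` separates from one it separates
  -- from the other.
  strict-between : ∀ {e a b c} → R b e a → Between e b c → Between a b c
  strict-between bea ebc bac = ebc (transitive bea bac)

  data Ordered : List A → Set where
    []  : Ordered []
    _∷_ : ∀ {x xs} → AllPairs (Between x) xs → Ordered xs → Ordered (x ∷ xs)

  ordered-++ : ∀ {xs ys} → Ordered xs → Ordered ys →
    AllPairs (λ a b → All (Between a b) ys) xs → All (λ a → AllPairs (Between a) ys) xs →
    Ordered (xs ++ ys)
  ordered-++ []       oys _          _          = oys
  ordered-++ (p ∷ ox) oys (q ∷ qs) (r ∷ rs) = allPairs-++ p r q ∷ ordered-++ ox oys qs rs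

  ordered-reverse : ∀ {xs} → Ordered xs → Ordered (reverse xs)
  ordered-reverse []                  = []
  ordered-reverse {x ∷ xs} (p ∷ ox) = subst Ordered (≡-sym (unfold-reverse x xs))
    (ordered-++ (ordered-reverse ox) ([] ∷ [])
      (AllPairs.map (λ xba → (λ r → xba (symmetric r)) ∷ []) (allPairs-reverse p))
      (All.tabulate (λ _ → [] ∷ [])))

  ordered-lookup : ∀ {xs} → Ordered xs → ∀ {i j l} → toℕ i < toℕ j → toℕ j < toℕ l →
    Between (lookup xs i) (lookup xs j) (lookup xs l)
  ordered-lookup (p ∷ _)  {zero}  {suc j} {suc l} _         (s≤s j<l) = allPairs-lookup p j<l
  ordered-lookup (_ ∷ ox) {suc i} {suc j} {suc l} (s≤s i<j) (s≤s j<l) = ordered-lookup ox i<j j<l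

  -- Seen from an extreme element the preorder of distances is total, so that the list can be sorted
  -- by distance from it.
  Extreme : A → List A → Set
  Extreme e xs = ∀ {a b} → a ∈ xs → b ∈ xs → Between e a b ⊎ Between e b a

  -- If neither of `a` and `b` separated the other from `e`, then `e`, `a`, `b` would be an
  -- asteroidal triple.
  both-sides⇒extreme : ∀ {e a b} → R e a b → Between e a b ⊎ Between e b a
  both-sides⇒extreme {e} {a} {b} eab with connected? a e b
  ... | no  ¬r = inj₁ ¬r
  ... | yes r  = inj₂ (λ r′ → no-asteroidal eab r r′)

  -- The elements farthest from a base point form a class of mutually
  -- indistinguishable ones; an extreme element of that class is extreme overall.
  extreme-∈ : ∀ m x xs → length xs ≤ m → ∃ λ e → e ∈ x ∷ xs × Extreme e (x ∷ xs)
  extreme-∈ m s []       _ = s , here refl , λ { (here refl) _ → inj₁ removed }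
  extreme-∈ (suc m) s (x ∷ xs) (s≤s len)
    with maximal-∈ {_≼_ = Between s} (between? s) between-refl between-trans x xs
  ... | t , t∈ , t-max with filter (between? s t) (x ∷ xs)
                          | ∈-filter⁺ (between? s t) t∈ between-refl
                          | (λ {v} → ∈-filter⁻ (between? s t) {v} {x ∷ xs})
                          | (λ {v} → ∈-filter⁺ (between? s t) {v} {x ∷ xs})
                          | length-filter (between? s t) (x ∷ xs)
  ... | y ∷ ys | _ | from | to | s≤s len′ with extreme-∈ m y ys (≤-trans len′ len)
  ... | e , e∈T , e-ext = e , there (proj₁ (from e∈T)) , extreme
    where
    T = y ∷ ys
    rest : A → Set
    rest a = a ≡ s ⊎ R t s a
    split : ∀ {a} → a ∈ s ∷ x ∷ xs → a ∈ T ⊎ rest a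
    split (here a≡s) = inj₂ (inj₁ a≡s)
    split {a} (there a∈) with between? s t a
    ... | yes p = inj₁ (to a∈ p)
    ... | no ¬p = inj₂ (inj₂ (¬between⇒R ¬p))
    tied : ∀ {a b} → a ∈ T → b ∈ T → Between s a b
    tied a∈ b∈ with from a∈ | from b∈
    ... | a∈′ , ta | _ , tb = between-trans (t-max a∈′ ta) tb
    near : ∀ {a b} → a ∈ T → R t s b → R a s b
    near a∈ r = ¬between⇒R (λ sab → between-trans (proj₂ (from a∈)) sab r)
    -- An element outside `T` is `s` or is connected to `s` off `a`. Were it also connected to `e`
    -- off `a`, then `a` would not separate `s` from `e`, although the two are tied.
    mixed : ∀ {a b} → a ∈ T → rest b → Between e a b
    mixed a∈ (inj₁ refl) r = tied a∈ e∈T (symmetric r)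
    mixed a∈ (inj₂ tsb)  r = tied a∈ e∈T (transitive (near a∈ tsb) (symmetric r))
    extreme : Extreme e (s ∷ x ∷ xs)
    extreme a∈ b∈ with split a∈ | split b∈
    ... | inj₁ a∈T | inj₁ b∈T = e-ext a∈T b∈T
    ... | inj₁ a∈T | inj₂ rb  = inj₁ (mixed a∈T rb)
    ... | inj₂ ra  | inj₁ b∈T = inj₂ (mixed b∈T ra)
    ... | inj₂ (inj₂ ra) | inj₂ (inj₂ rb) =
          both-sides⇒extreme (transitive (symmetric (near e∈T ra)) (near e∈T rb))
    ... | inj₂ (inj₁ refl) | inj₂ (inj₁ refl) = inj₁ between-refl
    ... | inj₂ (inj₁ refl) | inj₂ (inj₂ rb) = both-sides⇒extreme (near e∈T rb)
    ... | inj₂ (inj₂ ra) | inj₂ (inj₁ refl) = both-sides⇒extreme (symmetric (near e∈T ra))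

  record Arrangement (e : A) (xs : List A) : Set where
    field
      list     : List A
      complete : ∀ {a} → a ∈ xs → a ∈ list
      sound    : ∀ {a} → a ∈ list → a ∈ xs
      from-e   : AllPairs (Between e) list
      ordered  : Ordered list

  -- T: the elements nearest to e; f: a nearest one among the others.  All of T
  -- is on one side of f, so T can be arranged starting from f, and reversed.
  arrange : ∀ m e xs → length xs ≤ m → Extreme e xs → Arrangement e xs
  arrange m e [] _ _ = record
    { list = [] ; complete = λ () ; sound = λ () ; from-e = [] ; ordered = [] }
  arrange (suc m) e (x ∷ xs) (s≤s len) ext
    with maximal-∈ {_≼_ = λ a b → Between e b a} (λ a b → between? e b a) between-refl
                   (λ p q → between-trans q p) x xs
  ... | t , t∈ , t-min = go (filter far? L) refl
    where
    L = x ∷ xs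
    near? = λ a → between? e a t
    far? = λ a → ¬? (near? a)
    T = filter near? L
    U = filter far? L
    t-least : ∀ {b} → b ∈ L → Between e t b
    t-least b∈ with ext t∈ b∈
    ... | inj₁ p = p
    ... | inj₂ p = t-min b∈ p
    T-least : ∀ {a b} → a ∈ T → b ∈ L → Between e a b
    T-least a∈ b∈ = between-trans (proj₂ (∈-filter⁻ near? {xs = L} a∈)) (t-least b∈)
    U⊆L : ∀ {a} → a ∈ U → a ∈ L
    U⊆L a∈ = proj₁ (∈-filter⁻ far? {xs = L} a∈)
    T⊆L : ∀ {a} → a ∈ T → a ∈ L
    T⊆L a∈ = proj₁ (∈-filter⁻ near? {xs = L} a∈)
    T<U : ∀ {a b} → a ∈ T → b ∈ U → R b e a
    T<U a∈ b∈ = ¬between⇒R λ eba → proj₂ (∈-filter⁻ far? {xs = L} b∈)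
                  (between-trans eba (proj₂ (∈-filter⁻ near? {xs = L} a∈)))
    split : ∀ {a} → a ∈ L → a ∈ T ⊎ a ∈ U
    split {a} a∈ with near? a
    ... | yes p = inj₁ (∈-filter⁺ near? a∈ p)
    ... | no ¬p = inj₂ (∈-filter⁺ far? a∈ ¬p)
    U-short : length U ≤ m
    U-short = ≤-trans (≤-pred (filter-notAll far? L (lose t∈ (λ far → far between-refl)))) len
    go : ∀ us → us ≡ U → Arrangement e L
    -- All elements are tied as seen from `e`, so every ordered arrangement respects `e`; one
    -- beginning at an extreme element of `L` itself is taken.
    go [] U≡[] with extreme-∈ (length xs) x xs ≤-refl
    ... | e′ , e′∈ , e′-ext with arrange m e′ (filter (λ a → ¬? (a ≟ e′)) L)
           (≤-trans (≤-pred (filter-notAll (λ a → ¬? (a ≟ e′)) L (lose e′∈ (λ p → p refl)))) len)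
           (λ a∈ b∈ → e′-ext (proj₁ (∈-filter⁻ (λ a → ¬? (a ≟ e′)) {xs = L} a∈))
                             (proj₁ (∈-filter⁻ (λ a → ¬? (a ≟ e′)) {xs = L} b∈)))
    ... | arr = record
      { list     = list
      ; complete = complete
      ; sound    = sound
      ; from-e   = allPairs-tabulate list (λ a∈ b∈ → tied (sound a∈) (sound b∈))
      ; ordered  = Arrangement.from-e arr ∷ Arrangement.ordered arr
      }
      where
      list = e′ ∷ Arrangement.list arr
      tied : ∀ {a b} → a ∈ L → b ∈ L → Between e a b
      tied a∈ b∈ with split a∈
      ... | inj₁ a∈T = T-least a∈T b∈
      ... | inj₂ a∈U with () ← subst (_ ∈_) (≡-sym U≡[]) a∈U
      complete : ∀ {a} → a ∈ L → a ∈ list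
      complete {a} a∈ with a ≟ e′
      ... | yes refl = here refl
      ... | no a≢e′  = there (Arrangement.complete arr (∈-filter⁺ (λ a → ¬? (a ≟ e′)) a∈ a≢e′))
      sound : ∀ {a} → a ∈ list → a ∈ L
      sound (here refl) = e′∈
      sound (there a∈)  = proj₁ (∈-filter⁻ (λ a → ¬? (a ≟ e′)) {xs = L} (Arrangement.sound arr a∈))
    go (u ∷ us) U≡
      with maximal-∈ {_≼_ = λ a b → Between e b a} (λ a b → between? e b a) between-refl
                     (λ p q → between-trans q p) u us
    ... | f , f∈′ , f-min = record
      { list     = ts ++ zs
      ; complete = complete
      ; sound    = sound
      ; from-e   = allPairs-++
          (allPairs-tabulate ts (λ a∈ b∈ → T-least (ts⊆T a∈) (T⊆L (ts⊆T b∈))))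
          (Arrangement.from-e arrU)
          (All.tabulate (λ a∈ → All.tabulate (λ b∈ → T-least (ts⊆T a∈) (U⊆L (zs⊆U b∈)))))
      ; ordered  = ordered-++ (ordered-reverse (Arrangement.ordered arrT)) (Arrangement.ordered arrU)
          (allPairs-map-∈ (λ a∈ b∈ fba → All.tabulate (λ c∈ → TTU (ts⊆T a∈) (λ r → fba (symmetric r)) (zs⊆U c∈)))
            (allPairs-reverse (Arrangement.from-e arrT)))
          (All.tabulate (λ a∈ → allPairs-map-∈
            (λ b∈ _ ebc → strict-between (T<U (ts⊆T a∈) (zs⊆U b∈)) ebc) (Arrangement.from-e arrU)))
      }
      where
      f∈ : f ∈ U
      f∈ = subst (f ∈_) U≡ f∈′
      f-least : ∀ {c} → c ∈ U → Between e f c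
      f-least c∈ with ext (U⊆L f∈) (U⊆L c∈)
      ... | inj₁ p = p
      ... | inj₂ p = f-min (subst (_ ∈_) (≡-sym U≡) c∈) p
      T-short : length T ≤ m
      T-short = ≤-trans (≤-pred (filter-notAll near? L (lose (U⊆L f∈) (proj₂ (∈-filter⁻ far? {xs = L} f∈))))) len
      arrT = arrange m f T T-short
        (λ a∈ b∈ → both-sides⇒extreme (transitive (symmetric (T<U a∈ f∈)) (T<U b∈ f∈)))
      arrU = arrange m e U U-short (λ a∈ b∈ → ext (U⊆L a∈) (U⊆L b∈))
      ts = reverse (Arrangement.list arrT)
      zs = Arrangement.list arrU
      ts⊆T : ∀ {a} → a ∈ ts → a ∈ T
      ts⊆T a∈ = Arrangement.sound arrT (reverse⁻ a∈)
      zs⊆U : ∀ {a} → a ∈ zs → a ∈ U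
      zs⊆U = Arrangement.sound arrU
      -- `f` is nearest in `U` and hence separates `a` from `c`; whatever separates `a` from `f`
      -- therefore separates `a` from `c`.
      TTU : ∀ {a b c} → a ∈ T → Between a b f → c ∈ U → Between a b c
      TTU a∈ abf c∈ r with through f r
      ... | inj₁ r′ = strict-between (T<U a∈ f∈) (f-least c∈) r′
      ... | inj₂ r′ = abf r′
      complete : ∀ {a} → a ∈ L → a ∈ ts ++ zs
      complete a∈ with split a∈
      ... | inj₁ a∈T = ∈-++⁺ˡ (reverse⁺ (Arrangement.complete arrT a∈T))
      ... | inj₂ a∈U = ∈-++⁺ʳ ts (Arrangement.complete arrU a∈U)
      sound : ∀ {a} → a ∈ ts ++ zs → a ∈ L
      sound a∈ with ∈-++⁻ ts a∈
      ... | inj₁ a∈ts = T⊆L (ts⊆T a∈ts)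
      ... | inj₂ a∈zs = U⊆L (zs⊆U a∈zs)

  linear-order : ∀ xs → ∃ λ ys → (∀ {a} → a ∈ xs → a ∈ ys) × Ordered ys
  linear-order []       = [] , (λ ()) , []
  linear-order (x ∷ xs) with extreme-∈ (length xs) x xs ≤-refl
  ... | e , _ , ext with arrange (length (x ∷ xs)) e (x ∷ xs) ≤-refl ext
  ... | arr = Arrangement.list arr , Arrangement.complete arr , Arrangement.ordered arr

-- Minimal triangulations

module _ {n : ℕ} where

  module _ {P : Fin n → Set} (P? : ∀ v → Dec (P v)) where

    subsetOf : Subset n
    subsetOf = tabulate (does ∘ P?)

    ∈-subsetOf⁺ : ∀ {v} → P v → v Subset.∈ subsetOf
    ∈-subsetOf⁺ {v} p = lookup⇒[]= v subsetOf (trans (lookup∘tabulate _ v) (dec-true (P? v) p))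

    ∈-subsetOf⁻ : ∀ {v} → v Subset.∈ subsetOf → P v
    ∈-subsetOf⁻ {v} v∈ = witness (P? v) (trans (≡-sym (lookup∘tabulate _ v)) ([]=⇒lookup v∈))
      where
      witness : ∀ {A : Set} (a? : Dec A) → does a? ≡ true → A
      witness (yes a) _ = a

  -- For reflexive symmetric H this says that there is no induced cycle of length
  -- at least 4: given one through the edge x y, let U be its other vertices.
  Chordal : (Fin n → Fin n → Set) → Set₁
  Chordal H = ∀ {x y p q} (U : Fin n → Set) → H x y → H x p → H y q →
    Walk H U p q → ∃ λ z → U z × H x z × H y z

  Inside : (X Y : Fin n → Set) → Fin n → Fin n → Set
  Inside X Y u v = (X u × X v) ⊎ (Y u × Y v)

  -- `H′` glues the restrictions of `H` to `X` and to `Y` along the clique on their intersection and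
  -- drops the pairs joining the two differences.
  record IsCliqueSum (H : Fin n → Fin n → Set) (X Y : Fin n → Set) (H′ : Fin n → Fin n → Set) : Set where
    field
      X?     : ∀ v → Dec (X v)
      cover  : ∀ v → X v ⊎ Y v
      clique : ∀ {u v} → X u → Y u → X v → Y v → H u v
      inside : ∀ {u v} → H′ u v → Inside X Y u v
      lower  : ∀ {u v} → H′ u v → H u v
      raise  : ∀ {u v} → H u v → Inside X Y u v → H′ u v

    crossing : ∀ {u v} → H′ u v → ¬ X v → Y u
    crossing e ¬xv with inside e
    ... | inj₁ (_ , xv) = ⊥-elim (¬xv xv)
    ... | inj₂ (yu , _) = yu

    outside : ∀ {v} → ¬ X v → Y v
    outside {v} ¬x with cover v
    ... | inj₁ x = ⊥-elim (¬x x)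
    ... | inj₂ y = y

    lower-walk : ∀ {U p q} → Walk H′ U p q → Walk H U p q
    lower-walk (stay u)     = stay u
    lower-walk (move u e w) = move u (lower e) (lower-walk w)

    -- An end outside `X` is replaced by a vertex of the clique `X ∩ Y`, where the walk first enters
    -- or last leaves `X`.
    data Shortcut (U : Fin n → Set) (p q : Fin n) : Set where
      shortcut : ∀ {a b} → Walk H′ (λ v → U v × X v) a b →
        (a ≡ p ⊎ (¬ X p × Y a)) → (b ≡ q ⊎ (¬ X q × Y b)) → Shortcut U p q

    -- Every excursion out of X leaves and re-enters it through the clique X ∩ Y.
    project : (∀ {u v} → H′ u v → H′ v u) → ∀ {U p q} → Walk H′ U p q →
      (¬ X p × ¬ X q × Walk H′ (λ v → U v × Y v) p q) ⊎ Shortcut U p q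
    project H′-sym {p = p} (stay u) with X? p
    ... | yes x = inj₂ (shortcut (stay (u , x)) (inj₁ refl) (inj₁ refl))
    ... | no ¬x = inj₁ (¬x , ¬x , stay (u , outside ¬x))
    project H′-sym {p = p} (move {y = p′} u e w) with X? p | project H′-sym w
    ... | yes x | inj₁ (¬x′ , ¬xq , _) =
          inj₂ (shortcut (stay (u , x)) (inj₁ refl) (inj₂ (¬xq , crossing e ¬x′)))
    ... | no ¬x | inj₁ (¬x′ , ¬xq , w′) = inj₁ (¬x , ¬xq , move (u , outside ¬x) e w′)
    ... | yes x | inj₂ (shortcut w′ (inj₁ refl) end) =
          inj₂ (shortcut (move (u , x) e w′) (inj₁ refl) end)
    ... | yes x | inj₂ (shortcut w′ (inj₂ (¬x′ , ya)) end) =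
          let xa = proj₂ (walk-source w′) ; yp = crossing e ¬x′ in
          inj₂ (shortcut (move (u , x) (raise (clique x yp xa ya) (inj₁ (x , xa))) w′) (inj₁ refl) end)
    ... | no ¬x | inj₂ (shortcut w′ (inj₁ refl) end) =
          inj₂ (shortcut w′ (inj₂ (¬x , crossing (H′-sym e) ¬x)) end)
    ... | no ¬x | inj₂ (shortcut w′ (inj₂ (_ , ya)) end) =
          inj₂ (shortcut w′ (inj₂ (¬x , ya)) end)

    -- Chordality of `H` is applied to the projected walk. If `p` lies outside `X`, then `x` belongs
    -- to the separating clique and is adjacent to the vertex that replaces `p`; likewise for `q`
    -- and `y`.
    chord-in-X : (∀ {u v} → H′ u v → H′ v u) → Chordal H →
      ∀ {x y p q} (U : Fin n → Set) → X x → X y → H′ x y → H′ x p → H′ y q →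
      Walk H′ U p q → ∃ λ z → U z × H′ x z × H′ y z
    chord-in-X H′-sym chordal U xx xy exy exp eyq w with project H′-sym w
    ... | inj₁ (¬xp , ¬xq , w′) =
          let (z , (uz , yz) , hxz , hyz) =
                chordal _ (lower exy) (lower exp) (lower eyq) (lower-walk w′)
          in z , uz , raise hxz (inj₂ (crossing exp ¬xp , yz)) , raise hyz (inj₂ (crossing eyq ¬xq , yz))
    ... | inj₂ (shortcut w′ start end) =
          let (z , (uz , xz) , hxz , hyz) =
                chordal _ (lower exy) (meets exp xx start (proj₂ (walk-source w′)))
                          (meets eyq xy end (proj₂ (walk-target w′))) (lower-walk w′)
          in z , uz , raise hxz (inj₁ (xx , xz)) , raise hyz (inj₁ (xy , xz))
      where
      meets : ∀ {x p a} → H′ x p → X x → (a ≡ p ⊎ (¬ X p × Y a)) → X a → H x a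
      meets e xx (inj₁ refl)       _  = lower e
      meets e xx (inj₂ (¬xp , ya)) xa = clique xx (crossing e ¬xp) xa ya

  cliqueSum-chordal : ∀ {H X Y H′} → IsCliqueSum H X Y H′ → (∀ v → Dec (Y v)) →
    (∀ {u v} → H′ u v → H′ v u) → Chordal H → Chordal H′
  cliqueSum-chordal {H} {X} {Y} {H′} sum Y? H′-sym chordal U exy exp eyq w with IsCliqueSum.inside sum exy
  ... | inj₁ (xx , xy) = IsCliqueSum.chord-in-X sum H′-sym chordal U xx xy exy exp eyq w
  ... | inj₂ (yx , yy) = IsCliqueSum.chord-in-X flipped H′-sym chordal U yx yy exy exp eyq w
    where
    open IsCliqueSum sum
    flipped : IsCliqueSum H Y X H′
    flipped = record
      { X? = Y? ; cover = Sum.swap ∘ cover ; clique = λ yu xu yv xv → clique xu yu xv yv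
      ; inside = Sum.swap ∘ inside ; lower = lower ; raise = λ e → raise e ∘ Sum.swap }

  -- E: the edges of the graph; I: closed adjacency of a chordal supergraph.
  record MinimalTriangulation (E I : Fin n → Fin n → Set) : Set₁ where
    field
      Fill         : Fin n → Fin n → Set
      fill?        : ∀ u v → Dec (Fill u v)
      fill-refl    : ∀ {v} → Fill v v
      fill-sym     : ∀ {u v} → Fill u v → Fill v u
      fill-chordal : Chordal Fill
      edge⇒fill    : ∀ {u v} → E u v → Fill u v
      fill⇒super   : ∀ {u v} → Fill u v → I u v
      fill-minimal : ∀ {X Y : Fin n → Set} → (∀ v → Dec (X v)) → (∀ v → Dec (Y v)) →
        (∀ v → X v ⊎ Y v) → (∀ {u v} → X u → Y u → X v → Y v → Fill u v) →
        (∀ {u v} → E u v → Inside X Y u v) → ∀ {u v} → Fill u v → Inside X Y u v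

  module _ {E I : Fin n → Fin n → Set} (E? : ∀ u v → Dec (E u v)) where

    private
      open import Data.List.Membership.DecPropositional (≡-dec (_≟_ {n}) (_≟_ {n})) using (_∈?_)

      record Candidate (L : List (Fin n × Fin n)) : Set₁ where
        H : Fin n → Fin n → Set
        H u v = (u , v) ∈ L
        field
          H-refl    : ∀ v → H v v
          H-sym     : ∀ {u v} → H u v → H v u
          H-chordal : Chordal H
          E⊆H       : ∀ {u v} → E u v → H u v
          H⊆I       : ∀ {u v} → H u v → I u v

      inside? : ∀ {X Y : Fin n → Set} → (∀ v → Dec (X v)) → (∀ v → Dec (Y v)) → ∀ u v → Dec (Inside X Y u v)
      inside? X? Y? u v = (X? u ×-dec X? v) ⊎-dec (Y? u ×-dec Y? v)

      Splits : List (Fin n × Fin n) → (X Y : Fin n → Set) → Set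
      Splits L X Y =
        (∀ v → X v ⊎ Y v) ×
        (∀ u v → X u × Y u × X v × Y v → (u , v) ∈ L) ×
        (∀ u v → E u v → Inside X Y u v) ×
        ∃₂ λ u v → (u , v) ∈ L × ¬ Inside X Y u v

      splits? : ∀ L {X Y : Fin n → Set} → (∀ v → Dec (X v)) → (∀ v → Dec (Y v)) → Dec (Splits L X Y)
      splits? L X? Y? =
        all? (λ v → X? v ⊎-dec Y? v) ×-dec
        all? (λ u → all? λ v → (X? u ×-dec Y? u ×-dec X? v ×-dec Y? v) →-dec ((u , v) ∈? L)) ×-dec
        all? (λ u → all? λ v → E? u v →-dec inside? X? Y? u v) ×-dec
        any? (λ u → any? λ v → ((u , v) ∈? L) ×-dec ¬? (inside? X? Y? u v))

      module _ (L : List (Fin n × Fin n)) (C : Candidate L) {X Y : Fin n → Set}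
               (X? : ∀ v → Dec (X v)) (Y? : ∀ v → Dec (Y v)) (sp : Splits L X Y) where
        open Candidate C

        keep? : (e : Fin n × Fin n) → Dec (Inside X Y (proj₁ e) (proj₂ e))
        keep? (u , v) = inside? X? Y? u v

        shrink : Candidate (filter keep? L)
        shrink = record
          { H-refl    = λ v → ∈-filter⁺ keep? (H-refl v) (diagonal v)
          ; H-sym     = H′-sym
          ; H-chordal = cliqueSum-chordal cliqueSum Y? H′-sym H-chordal
          ; E⊆H       = λ e → ∈-filter⁺ keep? (E⊆H e) (proj₁ (proj₂ (proj₂ sp)) _ _ e)
          ; H⊆I       = λ h → H⊆I (proj₁ (∈-filter⁻ keep? {xs = L} h))
          }
          where
          diagonal : ∀ v → Inside X Y v v
          diagonal v with proj₁ sp v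
          ... | inj₁ x = inj₁ (x , x)
          ... | inj₂ y = inj₂ (y , y)
          inside-sym : ∀ {u v} → Inside X Y u v → Inside X Y v u
          inside-sym (inj₁ (a , b)) = inj₁ (b , a)
          inside-sym (inj₂ (a , b)) = inj₂ (b , a)
          H′-sym : ∀ {u v} → (u , v) ∈ filter keep? L → (v , u) ∈ filter keep? L
          H′-sym h with ∈-filter⁻ keep? {xs = L} h
          ... | h′ , i = ∈-filter⁺ keep? (H-sym h′) (inside-sym i)
          cliqueSum : IsCliqueSum H X Y (λ u v → (u , v) ∈ filter keep? L)
          cliqueSum = record
            { X? = X? ; cover = proj₁ sp
            ; clique = λ a b c d → proj₁ (proj₂ sp) _ _ (a , b , c , d)
            ; inside = λ h → proj₂ (∈-filter⁻ keep? {xs = L} h)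
            ; lower  = λ h → proj₁ (∈-filter⁻ keep? {xs = L} h)
            ; raise  = λ h i → ∈-filter⁺ keep? h i }

        shrink-< : length (filter keep? L) < length L
        shrink-< with proj₂ (proj₂ (proj₂ sp))
        ... | u , v , h , ¬i = filter-notAll keep? L (lose h ¬i)

      -- All pairs of subsets are searched for a clique sum that still contains the graph and loses
      -- a pair. Each one found shortens the list; when there is none, the fill is minimal.
      minimise : ∀ m L → length L ≤ m → Candidate L → MinimalTriangulation E I
      minimise m L len C with anySubset? (λ X → anySubset? (λ Y →
                               splits? L (Subset._∈? X) (Subset._∈? Y)))
      minimise zero    L len C | yes (X , Y , sp) with shrink-< L C (Subset._∈? X) (Subset._∈? Y) sp
      ... | lt with () ← ≤-trans lt len
      minimise (suc m) L len C | yes (X , Y , sp) =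
        minimise m _ (≤-pred (≤-trans (shrink-< L C (Subset._∈? X) (Subset._∈? Y) sp) len))
          (shrink L C (Subset._∈? X) (Subset._∈? Y) sp)
      minimise m L len C | no ¬splits = record
        { Fill = H ; fill? = λ u v → (u , v) ∈? L ; fill-refl = H-refl _ ; fill-sym = H-sym
        ; fill-chordal = H-chordal ; edge⇒fill = E⊆H ; fill⇒super = H⊆I
        ; fill-minimal = minimal }
        where
        open Candidate C
        minimal : ∀ {X Y : Fin n → Set} → (∀ v → Dec (X v)) → (∀ v → Dec (Y v)) →
          (∀ v → X v ⊎ Y v) → (∀ {u v} → X u → Y u → X v → Y v → H u v) →
          (∀ {u v} → E u v → Inside X Y u v) → ∀ {u v} → H u v → Inside X Y u v
        minimal {X} {Y} X? Y? cover clique resp {u} {v} h =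
          decidable-stable (inside? X? Y? u v) λ ¬i → ¬splits
            (subsetOf X? , subsetOf Y? ,
             (λ v → Sum.map (∈-subsetOf⁺ X?) (∈-subsetOf⁺ Y?) (cover v)) ,
             (λ u v (a , b , c , d) → clique (∈-subsetOf⁻ X? a) (∈-subsetOf⁻ Y? b) (∈-subsetOf⁻ X? c) (∈-subsetOf⁻ Y? d)) ,
             (λ u v e → Sum.map (Product.map (∈-subsetOf⁺ X?) (∈-subsetOf⁺ X?))
                                     (Product.map (∈-subsetOf⁺ Y?) (∈-subsetOf⁺ Y?)) (resp e)) ,
             u , v , h ,
             λ i → ¬i (Sum.map (Product.map (∈-subsetOf⁻ X?) (∈-subsetOf⁻ X?))
                                    (Product.map (∈-subsetOf⁻ Y?) (∈-subsetOf⁻ Y?)) i))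

    minimal-triangulation : (∀ u v → Dec (I u v)) → (∀ v → I v v) → (∀ {u v} → I u v → I v u) →
      Chordal I → (∀ {u v} → E u v → I u v) → MinimalTriangulation E I
    minimal-triangulation I? I-refl I-sym I-chordal E⊆I = minimise (length L) L ≤-refl record
      { H-refl = λ v → to (I-refl v) ; H-sym = λ h → to (I-sym (from h))
      ; H-chordal = λ U exy exp eyq w →
          let (z , u , a , b) = I-chordal U (from exy) (from exp) (from eyq) (walk-from w)
          in z , u , to a , to b
      ; E⊆H = λ e → to (E⊆I e) ; H⊆I = from }
      where
      pairs = cartesianProduct (allFin n) (allFin n)
      I?′ : (e : Fin n × Fin n) → Dec (I (proj₁ e) (proj₂ e))
      I?′ (u , v) = I? u v
      L = filter I?′ pairs
      to : ∀ {u v} → I u v → (u , v) ∈ L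
      to {u} {v} i = ∈-filter⁺ I?′ (∈-cartesianProduct⁺ (∈-allFin u) (∈-allFin v)) i
      from : ∀ {u v} → (u , v) ∈ L → I u v
      from h = proj₂ (∈-filter⁻ I?′ {xs = pairs} h)
      walk-from : ∀ {U p q} → Walk (λ u v → (u , v) ∈ L) U p q → Walk I U p q
      walk-from (stay u)     = stay u
      walk-from (move u e w) = move u (from e) (walk-from w)

  module _ {lo hi : Fin n → ℚ} where

    Overlap : Fin n → Fin n → Set
    Overlap u v = lo u ≤ℚ hi v × lo v ≤ℚ hi u

    private
      crossed : ∀ {U p q} c → Walk Overlap U p q → hi p <ℚ c → c <ℚ lo q →
        (∀ v → lo v ≤ℚ hi v) → ∃ λ z → U z × lo z ≤ℚ c × c ≤ℚ hi z
      crossed c (stay {x} _) p<c c<q lo≤hi =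
        ⊥-elim (ℚ.<-irrefl refl (ℚ.<-≤-trans (ℚ.<-trans p<c c<q) (lo≤hi x)))
      crossed c (move {y = y} u (_ , lo≤) w) p<c c<q lo≤hi with c ℚ.≤? hi y
      ... | no c≰  = crossed c w (ℚ.≰⇒> c≰) c<q lo≤hi
      ... | yes c≤ = y , walk-source w , ℚ.≤-trans lo≤ (ℚ.<⇒≤ p<c) , c≤

      overlap? : ∀ u v → Dec (Overlap u v)
      overlap? u v = (lo u ℚ.≤? hi v) ×-dec (lo v ℚ.≤? hi u)

      disjoint : ∀ {u v} → ¬ Overlap u v → hi u <ℚ lo v ⊎ hi v <ℚ lo u
      disjoint {u} {v} ¬o with lo u ℚ.≤? hi v | lo v ℚ.≤? hi u
      ... | no ¬a | _     = inj₂ (ℚ.≰⇒> ¬a)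
      ... | yes _ | no ¬b = inj₁ (ℚ.≰⇒> ¬b)
      ... | yes a | yes b = ⊥-elim (¬o (a , b))

    -- If `p` misses `y` and `q` misses `x`, then `p` and `q` lie on opposite sides of the later
    -- left end of `x` and `y`. That point belongs to both `x` and `y`, and the walk has to cover
    -- it.
    overlap-chordal : (∀ v → lo v ≤ℚ hi v) → Chordal Overlap
    overlap-chordal lo≤hi {x} {y} {p} {q} U (x≤y , y≤x) (x≤p , p≤x) (y≤q , q≤y) w
      with overlap? y p | overlap? x q
    ... | yes yp | _      = p , walk-source w , (x≤p , p≤x) , yp
    ... | no _   | yes xq = q , walk-target w , xq , (y≤q , q≤y)
    ... | no ¬yp | no ¬xq with disjoint ¬yp | disjoint ¬xq
    ... | inj₁ y<p | inj₁ x<q = ⊥-elim (ℚ.<-irrefl refl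
          (ℚ.<-trans (ℚ.<-≤-trans y<p p≤x) (ℚ.<-≤-trans x<q q≤y)))
    ... | inj₂ p<y | inj₂ q<x = ⊥-elim (ℚ.<-irrefl refl
          (ℚ.<-trans (ℚ.≤-<-trans x≤p p<y) (ℚ.≤-<-trans y≤q q<x)))
    ... | inj₂ p<y | inj₁ x<q =
          let (z , uz , a , b) = crossed (lo y) w p<y (ℚ.≤-<-trans y≤x x<q) lo≤hi
          in z , uz , (ℚ.≤-trans (ℚ.<⇒≤ (ℚ.≤-<-trans x≤p p<y)) b , ℚ.≤-trans a y≤x) ,
             (b , ℚ.≤-trans a (lo≤hi y))
    ... | inj₁ y<p | inj₂ q<x =
          let (z , uz , a , b) = crossed (lo x) (walk-reverse (λ (s , t) → t , s) w) q<x (ℚ.≤-<-trans x≤y y<p) lo≤hi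
          in z , uz , (b , ℚ.≤-trans a (lo≤hi x)) ,
             (ℚ.≤-trans (ℚ.<⇒≤ (ℚ.≤-<-trans y≤q q<x)) b , ℚ.≤-trans a x≤y)

-- The path of maximal cliques

least : ∀ {m} {P : Fin m → Set} → (∀ i → Dec (P i)) → ∃ P →
  ∃ λ i → P i × (∀ {j} → P j → toℕ i ≤ toℕ j)
least {suc m} {P} P? (k , pk) with P? zero
... | yes p0 = zero , p0 , λ _ → z≤n
least {suc m} {P} P? (zero  , pk) | no ¬p0 = ⊥-elim (¬p0 pk)
least {suc m} {P} P? (suc k , pk) | no ¬p0 with least (P? ∘ suc) (k , pk)
... | i , pi , min = suc i , pi , λ { {zero} p0 → ⊥-elim (¬p0 p0) ; {suc j} pj → s≤s (min pj) }

greatest : ∀ {m} {P : Fin m → Set} → (∀ i → Dec (P i)) → ∃ P →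
  ∃ λ i → P i × (∀ {j} → P j → toℕ j ≤ toℕ i)
greatest {suc m} {P} P? (k , pk) with any? (P? ∘ suc)
... | yes ∃p with greatest (P? ∘ suc) ∃p
...   | i , pi , max = suc i , pi , λ { {zero} _ → z≤n ; {suc j} pj → s≤s (max pj) }
greatest {suc m} {P} P? (zero  , pk) | no ¬∃p =
  zero , pk , λ { {zero} _ → z≤n ; {suc j} pj → ⊥-elim (¬∃p (j , pj)) }
greatest {suc m} {P} P? (suc k , pk) | no ¬∃p = ⊥-elim (¬∃p (k , pk))

-- Shared by the path of maximal cliques and the line of a maximal independent set: convexity makes
-- the positions of `v` an interval with ends `first v` and `last v`.
module Span {m n} {B : Fin m → Fin n → Set} (B? : ∀ i v → Dec (B i v))
            (inhabited : ∀ v → ∃ λ i → B i v)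
            (convex : ∀ {i j l v} → toℕ i < toℕ j → toℕ j < toℕ l → B i v → B l v → B j v) where

  private
    lst : ∀ v → _
    lst v = least (λ i → B? i v) (inhabited v)
    gst : ∀ v → _
    gst v = greatest (λ i → B? i v) (inhabited v)

  first last : Fin n → Fin m
  first v = proj₁ (lst v)
  last  v = proj₁ (gst v)

  first-∈ : ∀ v → B (first v) v
  first-∈ v = proj₁ (proj₂ (lst v))

  last-∈ : ∀ v → B (last v) v
  last-∈ v = proj₁ (proj₂ (gst v))

  first-≤ : ∀ {i v} → B i v → toℕ (first v) ≤ toℕ i
  first-≤ {v = v} = proj₂ (proj₂ (lst v))

  ≤-last : ∀ {i v} → B i v → toℕ i ≤ toℕ (last v)
  ≤-last {v = v} = proj₂ (proj₂ (gst v))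

  first≤last : ∀ v → toℕ (first v) ≤ toℕ (last v)
  first≤last v = first-≤ (last-∈ v)

  span-∈ : ∀ {i v} → toℕ (first v) ≤ toℕ i → toℕ i ≤ toℕ (last v) → B i v
  span-∈ {i} {v} f≤i i≤l with m≤n⇒m<n∨m≡n f≤i | m≤n⇒m<n∨m≡n i≤l
  ... | inj₂ f≡i | _        = subst (λ j → B j v) (toℕ-injective f≡i) (first-∈ v)
  ... | inj₁ _   | inj₂ i≡l = subst (λ j → B j v) (≡-sym (toℕ-injective i≡l)) (last-∈ v)
  ... | inj₁ f<i | inj₁ i<l = convex f<i i<l (first-∈ v) (last-∈ v)

module MaximalCliques {n : ℕ} {H : Fin n → Fin n → Set} (H? : ∀ u v → Dec (H u v))
                      (H-refl : ∀ {v} → H v v) (H-sym : ∀ {u v} → H u v → H v u) where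

  Clique : (Fin n → Set) → Set
  Clique K = ∀ {u v} → K u → K v → H u v

  MaximalClique : (Fin n → Set) → Set
  MaximalClique K = Clique K × (∀ {d} → (∀ {k} → K k → H k d) → K d)

  saturate : ∀ vs (K : Subset n) → Clique (Subset._∈ K) → ∃ λ K′ → Clique (Subset._∈ K′) × K Subset.⊆ K′ ×
    (∀ {v} → v ∈ vs → (∀ {k} → k Subset.∈ K′ → H k v) → v Subset.∈ K′)
  saturate []       K cl = K , cl , (λ k → k) , λ ()
  saturate (v ∷ vs) K cl with all? (λ k → (k Subset.∈? K) →-dec H? k v)
  ... | no ¬all with saturate vs K cl
  ...   | K′ , cl′ , K⊆K′ , max = K′ , cl′ , K⊆K′ , λ
          { (here refl) adj → ⊥-elim (¬all (λ k k∈ → adj (K⊆K′ k∈)))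
          ; (there v∈)      → max v∈ }
  saturate (v ∷ vs) K cl | yes all with saturate vs (K ∪ ⁅ v ⁆) cl₁
    where
    cl₁ : Clique (Subset._∈ (K ∪ ⁅ v ⁆))
    cl₁ a∈ b∈ with x∈p∪q⁻ K ⁅ v ⁆ a∈ | x∈p∪q⁻ K ⁅ v ⁆ b∈
    ... | inj₁ a | inj₁ b = cl a b
    ... | inj₁ a | inj₂ b with refl ← x∈⁅y⁆⇒x≡y v b = all _ a
    ... | inj₂ a | inj₁ b with refl ← x∈⁅y⁆⇒x≡y v a = H-sym (all _ b)
    ... | inj₂ a | inj₂ b with refl ← x∈⁅y⁆⇒x≡y v a | refl ← x∈⁅y⁆⇒x≡y v b = H-refl
  ... | K′ , cl′ , K⊆K′ , max = K′ , cl′ , (λ k → K⊆K′ (p⊆p∪q ⁅ v ⁆ k)) , λ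
          { (here refl) _ → K⊆K′ (q⊆p∪q K ⁅ v ⁆ (x∈⁅x⁆ v))
          ; (there v∈)    → max v∈ }

  extend : ∀ (K : Subset n) → Clique (Subset._∈ K) →
    ∃ λ K′ → MaximalClique (Subset._∈ K′) × K Subset.⊆ K′
  extend K cl with saturate (allFin n) K cl
  ... | K′ , cl′ , K⊆K′ , max = K′ , (cl′ , λ adj → max (∈-allFin _) adj) , K⊆K′

walk⇒pathAvoiding : ∀ {n} {G : Graph n} {U z x y} → (∀ {v} → U v → ¬ InClosedNbhd G z v) →
  Walk (Adj G) U x y → PathAvoiding G z x y
walk⇒pathAvoiding f (stay u)     = stop (f u)
walk⇒pathAvoiding f (move u e w) = step (f u) e (walk⇒pathAvoiding f w)

module Triangulated {n : ℕ} (G : Graph n) {I : Fin n → Fin n → Set}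
                    (MT : MinimalTriangulation (Adj G) I) where
  open MinimalTriangulation MT public

  open MaximalCliques fill? fill-refl fill-sym public

  -- `D` is a union of components of the graph minus the clique `K`. Gluing `D` with its attachment
  -- in `K` to the complement of `D` is a clique sum containing the graph, so by minimality fill
  -- leaves `D` only towards that attachment.
  full : ∀ {K D : Fin n → Set} → (∀ v → Dec (K v)) → (∀ v → Dec (D v)) → Clique K →
    (∀ {v} → D v → ¬ K v) → (∀ {v w} → D v → Adj G v w → ¬ K w → D w) →
    ∀ {d w} → D d → Fill d w → D w ⊎ (K w × ∃ λ d′ → D d′ × Adj G d′ w)
  full {K} {D} K? D? clique disj closed {d} {w} dd f with
      fill-minimal {X = X} {Y = λ v → ¬ D v} X? (λ v → ¬? (D? v)) cover
        (λ xu yu xv yv → clique (inK xu yu) (inK xv yv)) respects f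
    where
    X : Fin n → Set
    X v = D v ⊎ (K v × ∃ λ d′ → D d′ × Adj G d′ v)
    X? : ∀ v → Dec (X v)
    X? v = D? v ⊎-dec (K? v ×-dec any? (λ d′ → D? d′ ×-dec adj? G d′ v))
    cover : ∀ v → X v ⊎ ¬ D v
    cover v with D? v
    ... | yes p = inj₁ (inj₁ p)
    ... | no ¬p = inj₂ ¬p
    inK : ∀ {v} → X v → ¬ D v → K v
    inK (inj₁ p)       ¬p = ⊥-elim (¬p p)
    inK (inj₂ (k , _)) _  = k
    next : ∀ {u v} → D u → Adj G u v → X v
    next {u} {v} du e with K? v
    ... | yes kv = inj₂ (kv , u , du , e)
    ... | no ¬kv = inj₁ (closed du e ¬kv)
    respects : ∀ {u v} → Adj G u v → Inside X (λ v → ¬ D v) u v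
    respects {u} {v} e with D? u | D? v
    ... | yes du | _      = inj₁ (inj₁ du , next du e)
    ... | no _   | yes dv = inj₁ (next dv (Graph.sym G e) , inj₁ dv)
    ... | no ¬du | no ¬dv = inj₂ (¬du , ¬dv)
  ... | inj₁ (_ , xw) = xw
  ... | inj₂ (¬dd , _) = ⊥-elim (¬dd dd)

  module Removed {K : Fin n → Set} (K? : ∀ v → Dec (K v)) (clique : Clique K) where

    Comp : Fin n → Fin n → Set
    Comp p = Walk (Adj G) (λ v → ¬ K v) p

    comp? : ∀ p v → Dec (Comp p v)
    comp? = walk? (adj? G) (λ v → ¬? (K? v))

    comp-full : ∀ {p d w} → Comp p d → Fill d w → Comp p w ⊎ (K w × ∃ λ d′ → Comp p d′ × Adj G d′ w)
    comp-full {p} = full K? (comp? p) clique walk-target walk-∷ʳ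

    -- Fill that leaves a component of the graph minus `K` ends in `K`, so the graph and its fill
    -- have the same components off `K`.
    fill-walk⇒comp : ∀ {p q} → Walk Fill (λ v → ¬ K v) p q → Comp p q
    fill-walk⇒comp {p} w = walk-closed onward (stay (walk-source w)) w
      where
      onward : ∀ {v w} → Comp p v → Fill v w → ¬ K w → Comp p w
      onward c f ¬k with comp-full c f
      ... | inj₁ c′      = c′
      ... | inj₂ (k , _) = ⊥-elim (¬k k)

    comp-walk : ∀ {p u v} → Comp p u → Comp p v → Walk (Adj G) (Comp p) u v
    comp-walk c c′ = walk-++ (walk-reverse (Graph.sym G) (walk-within-component c)) (walk-within-component c′)

  adj-walk⇒fill-walk : ∀ {U p q} → Walk (Adj G) U p q → Walk Fill U p q
  adj-walk⇒fill-walk (stay u)     = stay u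
  adj-walk⇒fill-walk (move u e w) = move u (edge⇒fill e) (adj-walk⇒fill-walk w)

  -- The clique vertices are added one at a time: from a vertex adjacent to all earlier ones, walk
  -- to the first vertex `z` adjacent to `k`. For an earlier `k′`, chordality gives a common
  -- neighbour of `k′` and `k` on this walk, and only `z` is adjacent to `k`.
  dominated : ∀ {K D : Fin n → Set} {d₀} → Clique K → D d₀ →
    (∀ {d d′} → D d → D d′ → Walk Fill D d d′) → (∀ {k} → K k → ∃ λ d → D d × Fill k d) →
    ∀ ks → (∀ {k} → k ∈ ks → K k) → ∃ λ d → D d × (∀ {k} → k ∈ ks → Fill k d)
  dominated clique dd₀ conn nbr []       _  = _ , dd₀ , λ ()
  dominated clique dd₀ conn nbr (k ∷ ks) inK with dominated clique dd₀ conn nbr ks (inK ∘ there) | nbr (inK (here refl))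
  ... | d , dd , all | d′ , dd′ , kd′ with walk-until (fill? k) (conn dd dd′) kd′
  ... | z , kz , w = z , proj₁ (walk-target w) , adjacent
    where
    adjacent : ∀ {k′} → k′ ∈ k ∷ ks → Fill k′ z
    adjacent (here refl) = kz
    adjacent (there k′∈) with fill-chordal _ (clique (inK (there k′∈)) (inK (here refl))) (all k′∈) kz w
    ... | z′ , (_ , only) , k′z′ , kz′ = subst (Fill _) (only kz′) k′z′

  maximalClique-∋ : ∀ {u v} → Fill u v →
    ∃ λ K → MaximalClique (Subset._∈ K) × u Subset.∈ K × v Subset.∈ K
  maximalClique-∋ {u} {v} f with extend (⁅ u ⁆ ∪ ⁅ v ⁆) cl
    where
    cl : Clique (Subset._∈ (⁅ u ⁆ ∪ ⁅ v ⁆))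
    cl a∈ b∈ with x∈p∪q⁻ ⁅ u ⁆ ⁅ v ⁆ a∈ | x∈p∪q⁻ ⁅ u ⁆ ⁅ v ⁆ b∈
    ... | inj₁ a | inj₁ b with refl ← x∈⁅y⁆⇒x≡y u a | refl ← x∈⁅y⁆⇒x≡y u b = fill-refl
    ... | inj₁ a | inj₂ b with refl ← x∈⁅y⁆⇒x≡y u a | refl ← x∈⁅y⁆⇒x≡y v b = f
    ... | inj₂ a | inj₁ b with refl ← x∈⁅y⁆⇒x≡y v a | refl ← x∈⁅y⁆⇒x≡y u b = fill-sym f
    ... | inj₂ a | inj₂ b with refl ← x∈⁅y⁆⇒x≡y v a | refl ← x∈⁅y⁆⇒x≡y v b = fill-refl
  ... | K , max , sub = K , max ,
        sub (p⊆p∪q ⁅ v ⁆ (x∈⁅x⁆ u)) , sub (q⊆p∪q ⁅ u ⁆ ⁅ v ⁆ (x∈⁅x⁆ v))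

  Bag : Set
  Bag = Fin n × Fin n

  -- Maximal cliques are indexed by pairs: a filled pair names a clique containing it.
  private
    bag-of : (e : Bag) → ∃ λ K → MaximalClique (Subset._∈ K) ×
               (Fill (proj₁ e) (proj₂ e) → proj₁ e Subset.∈ K × proj₂ e Subset.∈ K)
    bag-of (u , v) with fill? u v
    ... | yes f with maximalClique-∋ f
    ...   | K , max , u∈ , v∈ = K , max , λ _ → u∈ , v∈
    bag-of (u , v) | no ¬f with maximalClique-∋ (fill-refl {u})
    ...   | K , max , _ = K , max , λ f → ⊥-elim (¬f f)

  _∋_ : Bag → Fin n → Set
  e ∋ v = v Subset.∈ proj₁ (bag-of e)

  ∋? : ∀ e v → Dec (e ∋ v)
  ∋? e v = v Subset.∈? proj₁ (bag-of e)

  bag-clique : ∀ e → Clique (e ∋_)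
  bag-clique e = proj₁ (proj₁ (proj₂ (bag-of e)))

  bag-maximal : ∀ e {d} → (∀ {k} → e ∋ k → Fill k d) → e ∋ d
  bag-maximal e = proj₂ (proj₁ (proj₂ (bag-of e)))

  bag-∋ : ∀ {u v} → Fill u v → (u , v) ∋ u × (u , v) ∋ v
  bag-∋ {u} {v} = proj₂ (proj₂ (bag-of (u , v)))

  Linked : Bag → Bag → Bag → Set
  Linked b a c = ∃₂ λ p q → a ∋ p × c ∋ q × Walk Fill (λ v → ¬ b ∋ v) p q

  -- `D` is the component of the graph minus the clique `c` that contains all the rest of `a` and of
  -- `b`; `far` is a vertex of `c` to which `D` is not attached.
  record Side (c a b : Bag) : Set₁ where
    field
      D         : Fin n → Set
      a∖c⊆D     : ∀ {v} → a ∋ v → ¬ c ∋ v → D v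
      b∖c⊆D     : ∀ {v} → b ∋ v → ¬ c ∋ v → D v
      D-avoids  : ∀ {v} → D v → ¬ c ∋ v
      D-walk    : ∀ {u v} → D u → D v → Walk (Adj G) D u v
      D-full    : ∀ {d k} → D d → c ∋ k → Fill d k → ∃ λ d′ → D d′ × Adj G d′ k
      far       : Fin n
      far-∈     : c ∋ far
      far-apart : ∀ {d} → D d → ¬ Adj G d far
      a-meets   : ∃ λ v → a ∋ v × D v
      b-meets   : ∃ λ v → b ∋ v × D v

  side : ∀ {c a b} → Linked c a b → Side c a b
  side {c} {a} {b} (p , q , ap , bq , w) = record
    { D = Comp p
    ; a∖c⊆D = reach ap (stay (walk-source w))
    ; b∖c⊆D = reach bq cq
    ; D-avoids = walk-target
    ; D-walk = comp-walk
    ; D-full = λ dd ck f → back (comp-full dd f) ck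
    ; far = proj₁ exposed
    ; far-∈ = proj₁ (proj₂ exposed)
    ; far-apart = λ dd e → proj₂ (proj₂ exposed) (_ , dd , e)
    ; a-meets = p , ap , stay (walk-source w)
    ; b-meets = q , bq , cq
    }
    where
    open Removed (∋? c) (bag-clique c)
    cq : Comp p q
    cq = fill-walk⇒comp w
    reach : ∀ {e s v} → e ∋ s → Comp p s → e ∋ v → ¬ c ∋ v → Comp p v
    reach {e} es cs ev ¬cv with comp-full cs (bag-clique e es ev)
    ... | inj₁ cv       = cv
    ... | inj₂ (cv , _) = ⊥-elim (¬cv cv)
    back : ∀ {k} → Comp p k ⊎ (c ∋ k × ∃ λ d′ → Comp p d′ × Adj G d′ k) → c ∋ k →
      ∃ λ d′ → Comp p d′ × Adj G d′ k
    back (inj₁ dk)      ck = ⊥-elim (walk-target dk ck)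
    back (inj₂ (_ , x)) _  = x
    Attached : Fin n → Set
    Attached k = ∃ λ d → Comp p d × Adj G d k
    attached? : ∀ k → Dec (Attached k)
    attached? k = any? (λ d → comp? p d ×-dec adj? G d k)
    -- A component attached to all of a clique contains a vertex adjacent to all of it.
    exposed : ∃ λ k → c ∋ k × ¬ Attached k
    exposed with any? (λ k → ∋? c k ×-dec ¬? (attached? k))
    ... | yes found = found
    ... | no  none  = ⊥-elim (walk-target (proj₁ (proj₂ dom)) (bag-maximal c
            (λ {k} ck → proj₂ (proj₂ dom) (∈-filter⁺ (∋? c) (∈-allFin k) ck))))
      where
      all-attached : ∀ {k} → c ∋ k → ∃ λ d → Comp p d × Fill k d
      all-attached {k} ck with attached? k
      ... | yes (d , cd , e) = d , cd , fill-sym (edge⇒fill e)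
      ... | no ¬att          = ⊥-elim (none (k , ck , ¬att))
      dom = dominated (bag-clique c) (stay (walk-source w))
              (λ d d′ → adj-walk⇒fill-walk (comp-walk d d′)) all-attached
              (filter (∋? c) (allFin n)) (λ k∈ → proj₂ (∈-filter⁻ (∋? c) {xs = allFin n} k∈))

  -- An interval representation of the fill in which the clique at every position is maximal.
  -- Maximality will provide an interval that begins just after a given right end.
  record CliquePath : Set where
    field
      {bound}          : ℕ
      α β              : Fin n → ℕ
      α≤β              : ∀ v → α v ≤ β v
      β-bound          : ∀ v → β v < bound
      fill⇒overlap     : ∀ {u v} → Fill u v → α u ≤ β v × α v ≤ β u
      overlap⇒fill     : ∀ {u v} → α u ≤ β v → α v ≤ β u → Fill u v
      position-maximal : ∀ {i d} → i < bound → (∀ {v} → α v ≤ i → i ≤ β v → Fill v d) → α d ≤ i × i ≤ β d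

  module _ (at-free : ATFree G) where

    -- The three vertices `far` would be an asteroidal triple of the graph: each component avoids
    -- the closed neighbourhood of its own `far` and contains the other two.
    linked-no-asteroidal : ∀ {a b c} → Linked a b c → Linked b a c → Linked c a b → ⊥
    linked-no-asteroidal {a} {b} {c} la lb lc =
      at-free A.far B.far C.far
        ( (λ eq → B.D-avoids a∈B (subst (b ∋_) (≡-sym eq) B.far-∈))
        , (λ eq → C.D-avoids b∈C (subst (c ∋_) (≡-sym eq) C.far-∈))
        , (λ eq → C.D-avoids a∈C (subst (c ∋_) (≡-sym eq) C.far-∈))
        , B.far-apart a∈B , C.far-apart b∈C , C.far-apart a∈C
        , walk⇒pathAvoiding (avoid (side lc)) (C.D-walk a∈C b∈C)
        , walk⇒pathAvoiding (avoid (side la)) (A.D-walk b∈A c∈A)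
        , walk⇒pathAvoiding (avoid (side lb)) (B.D-walk a∈B c∈B))
      where
      module A = Side (side la)
      module B = Side (side lb)
      module C = Side (side lc)
      avoid : ∀ {a b c} (s : Side c a b) {v} → Side.D s v → ¬ InClosedNbhd G (Side.far s) v
      avoid s dv (inj₁ refl) = Side.D-avoids s dv (Side.far-∈ s)
      avoid s dv (inj₂ e)    = Side.far-apart s dv (Graph.sym G e)
      -- `e` has a vertex in the component. If `far` were in `e` too, the two would be filled, and
      -- `D-full` would give `far` a neighbour in the component.
      private-vertex : ∀ {a b c} (s : Side c a b) (e : Bag) → (∃ λ v → e ∋ v × Side.D s v) → ¬ e ∋ Side.far s
      private-vertex s e (v , ev , dv) ef with Side.D-full s dv (Side.far-∈ s) (bag-clique e ev ef)
      ... | d , dd , adj = Side.far-apart s dd adj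
      a∈C : C.D A.far
      a∈C = C.a∖c⊆D A.far-∈ (private-vertex (side la) c A.b-meets)
      a∈B : B.D A.far
      a∈B = B.a∖c⊆D A.far-∈ (private-vertex (side la) b A.a-meets)
      b∈C : C.D B.far
      b∈C = C.b∖c⊆D B.far-∈ (private-vertex (side lb) c B.b-meets)
      b∈A : A.D B.far
      b∈A = A.a∖c⊆D B.far-∈ (private-vertex (side lb) a B.a-meets)
      c∈A : A.D C.far
      c∈A = A.b∖c⊆D C.far-∈ (private-vertex (side lc) a C.a-meets)
      c∈B : B.D C.far
      c∈B = B.b∖c⊆D C.far-∈ (private-vertex (side lc) b C.b-meets)

    linked-asteroidalFree : AsteroidalFree Linked
    linked-asteroidalFree = record
      { connected? = λ b a c → any? λ p → any? λ q →
          ∋? a p ×-dec ∋? c q ×-dec walk? fill? (λ v → ¬? (∋? b v)) p q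
      ; symmetric = λ (p , q , ap , cq , w) → q , p , cq , ap , walk-reverse fill-sym w
      ; transitive = λ { {b} {a} {c} (p , q , ap , cq , w) (p′ , q′ , cp′ , dq′ , w′) →
          p , q′ , ap , dq′ , walk-++ w (move (walk-target w) (bag-clique c cq cp′) w′) }
      ; removed = λ (p , q , ap , _ , w) → walk-source w ap
      ; through = through
      ; no-asteroidal = linked-no-asteroidal
      }
      where
      through : ∀ {a c e} b → Linked a e c → Linked b e c ⊎ Linked a e b
      through b (p , q , ep , cq , w) with walk-avoids-or-meets (∋? b) w
      ... | inj₁ w′            = inj₁ (p , q , ep , cq , walk-map proj₂ w′)
      ... | inj₂ (z , bz , w′) = inj₂ (p , z , ep , bz , w′)

    private
      bags : List Bag
      bags = cartesianProduct (allFin n) (allFin n)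
      open LinearOrder (≡-dec (_≟_ {n}) (_≟_ {n})) linked-asteroidalFree
      order = linear-order bags

    path : List Bag
    path = proj₁ order

    private
      position : ∀ {u v} → Fill u v → ∃ λ i → lookup path i ∋ u × lookup path i ∋ v
      position {u} {v} f = index uv∈ , subst (_∋ u) eq (proj₁ (bag-∋ f)) , subst (_∋ v) eq (proj₂ (bag-∋ f))
        where
        uv∈ : (u , v) ∈ path
        uv∈ = proj₁ (proj₂ order) (∈-cartesianProduct⁺ (∈-allFin u) (∈-allFin v))
        eq = lookup-index uv∈

      inhabited : ∀ v → ∃ λ i → lookup path i ∋ v
      inhabited v = let (i , p , _) = position (fill-refl {v}) in i , p

      -- A vertex of both outer bags that is missing from the middle one links them by a one-vertex
      -- walk.
      convex : ∀ {i j l v} → toℕ i < toℕ j → toℕ j < toℕ l →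
        lookup path i ∋ v → lookup path l ∋ v → lookup path j ∋ v
      convex {j = j} {v = v} i<j j<l p q = decidable-stable (∋? (lookup path j) v) λ ¬r →
        ordered-lookup (proj₂ (proj₂ order)) i<j j<l (v , v , p , q , stay ¬r)

      module S = Span (λ i → ∋? (lookup path i)) inhabited convex

    cliquePath : CliquePath
    cliquePath = record
      { α = α ; β = β ; α≤β = S.first≤last ; β-bound = λ v → toℕ<n (S.last v)
      ; fill⇒overlap = fill⇒overlap ; overlap⇒fill = overlap⇒fill ; position-maximal = position-maximal }
      where
      α β : Fin n → ℕ
      α v = toℕ (S.first v)
      β v = toℕ (S.last v)
      fill⇒overlap : ∀ {u v} → Fill u v → α u ≤ β v × α v ≤ β u
      fill⇒overlap f with position f
      ... | i , iu , iv = ≤-trans (S.first-≤ iu) (S.≤-last iv) , ≤-trans (S.first-≤ iv) (S.≤-last iu)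
      overlap⇒fill : ∀ {u v} → α u ≤ β v → α v ≤ β u → Fill u v
      overlap⇒fill {u} {v} p q with ≤-total (α u) (α v)
      ... | inj₁ r = bag-clique _ (S.span-∈ r q) (S.first-∈ v)
      ... | inj₂ r = bag-clique _ (S.first-∈ u) (S.span-∈ r p)
      position-maximal : ∀ {i d} → i < length path → (∀ {v} → α v ≤ i → i ≤ β v → Fill v d) → α d ≤ i × i ≤ β d
      position-maximal {i} {d} i< adj = subst (α d ≤_) i′≡i (S.first-≤ d∈) , subst (_≤ β d) i′≡i (S.≤-last d∈)
        where
        i′ = fromℕ< i<
        i′≡i : toℕ i′ ≡ i
        i′≡i = toℕ-fromℕ< i<
        d∈ : lookup path i′ ∋ d
        d∈ = bag-maximal (lookup path i′) λ {k} k∈ →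
          adj (subst (α k ≤_) i′≡i (S.first-≤ k∈)) (subst (_≤ β k) i′≡i (S.≤-last k∈))

-- Ranks and claws

module Greedy {n : ℕ} {α β : Fin n → ℕ} (α≤β : ∀ v → α v ≤ β v) where

  Ends : ℕ → ℕ → Set
  Ends t i = ∃ λ w → t ≤ α w × β w ≡ i

  ends? : ∀ t i → Dec (Ends t i)
  ends? t i = any? λ w → (t ≤? α w) ×-dec (β w ℕ.≟ i)

  -- Stabbing points are placed greedily at the earliest right ends: threshold i
  -- is 1 + the last one below i (0 if none), and count i is their number.
  threshold count : ℕ → ℕ
  threshold zero    = zero
  threshold (suc i) = if does (ends? (threshold i) i) then suc i else threshold i
  count zero    = zero
  count (suc i) = if does (ends? (threshold i) i) then suc (count i) else count i

  data Advance (i : ℕ) : Set where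
    stab : Ends (threshold i) i → threshold (suc i) ≡ suc i → count (suc i) ≡ suc (count i) → Advance i
    skip : ¬ Ends (threshold i) i → threshold (suc i) ≡ threshold i → count (suc i) ≡ count i → Advance i

  advance : ∀ i → Advance i
  advance i with ends? (threshold i) i in eq
  ... | yes e = stab e (cong (λ d → if does d then suc i else threshold i) eq)
                       (cong (λ d → if does d then suc (count i) else count i) eq)
  ... | no ¬e = skip ¬e (cong (λ d → if does d then suc i else threshold i) eq)
                        (cong (λ d → if does d then suc (count i) else count i) eq)

  threshold-≤ : ∀ i → threshold i ≤ i
  threshold-≤ zero    = z≤n
  threshold-≤ (suc i) with advance i
  ... | stab _ t _ = ≤-reflexive t
  ... | skip _ t _ = ≤-trans (≤-reflexive t) (≤-trans (threshold-≤ i) (n≤1+n i))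

  threshold-origin : ∀ i → threshold i ≡ 0 ⊎ ∃ λ w → threshold i ≡ suc (β w)
  threshold-origin zero    = inj₁ refl
  threshold-origin (suc i) with advance i
  ... | stab (w , _ , refl) t _ = inj₂ (w , t)
  ... | skip _ t _ with threshold-origin i
  ...   | inj₁ z       = inj₁ (trans t z)
  ...   | inj₂ (w , s) = inj₂ (w , trans t s)

  count-suc : ∀ i → count i ≤ count (suc i)
  count-suc i with advance i
  ... | stab _ _ c = ≤-trans (n≤1+n _) (≤-reflexive (≡-sym c))
  ... | skip _ _ c = ≤-reflexive (≡-sym c)

  count-mono : ∀ {i j} → i ≤ j → count i ≤ count j
  count-mono {j = zero}  z≤n = ≤-refl
  count-mono {j = suc j} i≤j with m≤n⇒m<n∨m≡n i≤j
  ... | inj₁ (s≤s i≤j′) = ≤-trans (count-mono i≤j′) (count-suc j)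
  ... | inj₂ refl       = ≤-refl

  count-jump : ∀ {i j} → i ≤ j → i < threshold j → count i < count j
  count-jump {i} {zero}  _   ()
  count-jump {i} {suc j} i≤j lt with m≤n⇒m<n∨m≡n i≤j
  ... | inj₂ refl = ⊥-elim (ℕ.<-irrefl refl (<-≤-trans lt (threshold-≤ (suc j))))
  ... | inj₁ (s≤s i≤j′) with advance j
  ...   | stab _ _ c = <-≤-trans (s≤s (count-mono i≤j′)) (≤-reflexive (≡-sym c))
  ...   | skip _ t c = <-≤-trans (count-jump i≤j′ (<-≤-trans lt (≤-reflexive t))) (≤-reflexive (≡-sym c))

  rank : Fin n → ℕ
  rank v = count (α v)

  -- The interval of `u` is stabbed: either a point was placed in it before `β u`, or `u` itself
  -- forces one at `β u`. That point lies below `α v` but not below `α u`.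
  rank-< : ∀ {u v} → β u < α v → rank u < rank v
  rank-< {u} {v} lt with threshold (β u) ≤? α u
  ... | no ≰  = <-≤-trans (count-jump (α≤β u) (≰⇒> ≰)) (count-mono (<⇒≤ lt))
  ... | yes t≤ with advance (β u)
  ...   | stab _ _ c = ≤-trans (≤-trans (s≤s (count-mono (α≤β u))) (≤-reflexive (≡-sym c))) (count-mono lt)
  ...   | skip ¬e _ _ = ⊥-elim (¬e (u , t≤ , refl))

module ClawBound {n : ℕ} (G : Graph n) {I : Fin n → Fin n → Set}
                 (MT : MinimalTriangulation (Adj G) I) (at-free : ATFree G)
                 (path : Triangulated.CliquePath G MT) where
  private module T = Triangulated G MT
  open T using (Fill)
  open T.CliquePath path public

  edge⇒overlap : ∀ {u v} → Adj G u v → α u ≤ β v × α v ≤ β u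
  edge⇒overlap e = fill⇒overlap (T.edge⇒fill e)

  overlap⇒super : ∀ {u v} → α u ≤ β v → α v ≤ β u → I u v
  overlap⇒super p q = T.fill⇒super (overlap⇒fill p q)

  private
    At : ℕ → Fin n → Set
    At i v = α v ≤ i × i ≤ β v

    at? : ∀ i v → Dec (At i v)
    at? i v = (α v ≤? i) ×-dec (i ≤? β v)

    at-clique : ∀ i → T.Clique (At i)
    at-clique i (a , b) (c , d) = overlap⇒fill (≤-trans a d) (≤-trans c b)

    module At (i : ℕ) = T.Removed (at? i) (at-clique i)

    before⇒¬near : ∀ {z v} → β v < α z → ¬ InClosedNbhd G z v
    before⇒¬near {z} lt (inj₁ refl) = ℕ.<-irrefl refl (<-≤-trans lt (α≤β z))
    before⇒¬near lt (inj₂ e) = ℕ.<-irrefl refl (<-≤-trans lt (proj₁ (edge⇒overlap e)))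

    after⇒¬near : ∀ {z v} → β z < α v → ¬ InClosedNbhd G z v
    after⇒¬near {z} lt (inj₁ refl) = ℕ.<-irrefl refl (<-≤-trans lt (α≤β z))
    after⇒¬near lt (inj₂ e) = ℕ.<-irrefl refl (<-≤-trans lt (proj₂ (edge⇒overlap e)))

  -- If u had no neighbour in the window (q , q′] then the component D of x there
  -- would, by minimality, be attached to both cliques bounding the window; with
  -- the full components L and R beyond them it yields an asteroidal triple l, x, r.
  module Window {u l x : Fin n} (l<x : β l < α x) (u≤l : α u ≤ β l) (x<u : β x < β u)
                (none : ¬ ∃ λ y → Adj G u y × β l < α y × β y ≤ β x) where
    private
      q q′ : ℕ
      q  = β l
      q′ = β x

      V : Fin n → Set
      V v = q < α v × β v ≤ q′

      v? : ∀ v → Dec (V v)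
      v? v = (q <? α v) ×-dec (β v ≤? q′)

      Vx : V x
      Vx = l<x , ≤-refl

      D : Fin n → Set
      D = Walk (Adj G) V x

      D? : ∀ v → Dec (D v)
      D? = walk? (adj? G) v? x

      q<q′ : q < q′
      q<q′ = <-≤-trans l<x (α≤β x)

      q<βu : q < β u
      q<βu = <-≤-trans q<q′ (<⇒≤ x<u)

      Attached : Fin n → Set
      Attached v = ∃ λ d → D d × Adj G d v

      attached? : ∀ v → Dec (Attached v)
      attached? v = any? λ d → D? d ×-dec adj? G d v

      ux : Fill x u
      ux = overlap⇒fill (<⇒≤ (≤-<-trans (α≤β x) x<u)) (≤-trans u≤l (<⇒≤ q<q′))

      not-u : ∀ {K : Set} → D u ⊎ (K × Attached u) → ⊥
      not-u (inj₁ du) = ℕ.<-irrefl refl (<-≤-trans (proj₁ (walk-target du)) u≤l)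
      not-u (inj₂ (_ , d , dd , e)) = none (d , Graph.sym G e , walk-target dd)

      -- Otherwise every neighbour of `D` outside `D` contains the position `suc q′`, and `full`
      -- turns the fill between `x` and `u` into an edge from `D` to `u`. The clique is taken at
      -- `suc q′` because vertices of `D` may end at `q′`.
      left-attachment : ∃ λ a → Attached a × α a ≤ q × β a ≤ q′
      left-attachment with any? (λ a → attached? a ×-dec (α a ≤? q) ×-dec (β a ≤? q′))
      ... | yes found  = found
      ... | no nowhere = ⊥-elim (not-u (T.full (at? (suc q′)) D? (at-clique (suc q′))
              (λ dv (_ , lt) → ℕ.<-irrefl refl (<-≤-trans lt (proj₂ (walk-target dv)))) closed (stay Vx) ux))
        where
        closed : ∀ {v w} → D v → Adj G v w → ¬ At (suc q′) w → D w
        closed {v} {w} dv e ¬k with v? w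
        ... | yes vw = walk-∷ʳ dv e vw
        ... | no ¬vw with β w ≤? q′ | q <? α w
        ...   | yes p | yes r = ⊥-elim (¬vw (r , p))
        ...   | yes p | no r  = ⊥-elim (nowhere (w , (v , dv , e) , ≮⇒≥ r , p))
        ...   | no p  | _     = ⊥-elim (¬k (≤-trans (proj₂ (edge⇒overlap e)) (≤-trans (proj₂ (walk-target dv)) (n≤1+n q′)) , ≰⇒> p))

      right-attachment : ∃ λ b → Attached b × q < α b × q′ < β b
      right-attachment with any? (λ b → attached? b ×-dec (q <? α b) ×-dec (q′ <? β b))
      ... | yes found  = found
      ... | no nowhere = ⊥-elim (not-u (T.full (at? q) D? (at-clique q)
              (λ dv (le , _) → ℕ.<-irrefl refl (<-≤-trans (proj₁ (walk-target dv)) le)) closed (stay Vx) ux))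
        where
        closed : ∀ {v w} → D v → Adj G v w → ¬ At q w → D w
        closed {v} {w} dv e ¬k with v? w
        ... | yes vw = walk-∷ʳ dv e vw
        ... | no ¬vw with q <? α w | β w ≤? q′
        ...   | yes p | yes r = ⊥-elim (¬vw (p , r))
        ...   | yes p | no r  = ⊥-elim (nowhere (w , (v , dv , e) , p , ≰⇒> r))
        ...   | no p  | _     = ⊥-elim (¬k (≮⇒≥ p , ≤-trans (<⇒≤ (proj₁ (walk-target dv))) (proj₁ (edge⇒overlap e))))

      L : Fin n → Set
      L = At.Comp (suc q) l

      L-start : L l
      L-start = stay λ (_ , lt) → ℕ.<-irrefl refl lt

      L-left : ∀ {v} → L v → β v ≤ q
      L-left = walk-closed (λ {v} {w} p e ¬k → ≤-pred (≰⇒> λ lt →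
        ¬k (≤-trans (proj₂ (edge⇒overlap e)) (≤-trans p (n≤1+n q)) , lt))) ≤-refl

      -- `s` meets `l` at `q`, so the two are filled; since `s` extends beyond `q` it is not in `L`,
      -- and fullness of the component gives an edge.
      L-attached : ∀ {s} → α s ≤ q → q < β s → ∃ λ d → L d × Adj G d s
      L-attached p r with At.comp-full (suc q) L-start (overlap⇒fill (≤-trans (α≤β l) (<⇒≤ r)) p)
      ... | inj₁ c       = ⊥-elim (ℕ.<-irrefl refl (<-≤-trans r (L-left c)))
      ... | inj₂ (_ , d) = d

      -- If no interval began at `suc q′`, all intervals there would also contain `q′` and meet `x`,
      -- so `x` could be added to a maximal clique.
      right-end : ∃ λ r → α r ≡ suc q′
      right-end with any? (λ r → α r ℕ.≟ suc q′)
      ... | yes found  = found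
      ... | no nowhere = ⊥-elim (ℕ.<-irrefl refl (proj₂ (position-maximal {suc q′} {x}
              (≤-<-trans x<u (β-bound u)) λ {v} p r → overlap⇒fill
                (≤-pred (ℕ.≤∧≢⇒< p (λ eq → nowhere (v , eq))))
                (≤-trans (α≤β x) (<⇒≤ r)))))

      r : Fin n
      r = proj₁ right-end

      αr : q′ < α r
      αr = ≤-reflexive (≡-sym (proj₂ right-end))

      R : Fin n → Set
      R = At.Comp q′ r

      R-start : R r
      R-start = stay λ (le , _) → ℕ.<-irrefl refl (<-≤-trans αr le)

      R-right : ∀ {v} → R v → q′ < α v
      R-right = walk-closed (λ {v} {w} p e ¬k → ≰⇒> λ le →
        ¬k (le , <⇒≤ (<-≤-trans p (proj₁ (edge⇒overlap e))))) αr

      R-attached : ∀ {s} → α s ≤ q′ → q′ < β s → ∃ λ d → R d × Adj G d s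
      R-attached p s with At.comp-full q′ R-start (overlap⇒fill
                            (≤-trans (≤-reflexive (proj₂ right-end)) s) (≤-trans p (<⇒≤ (<-≤-trans αr (α≤β r)))))
      ... | inj₁ c       = ⊥-elim (ℕ.<-irrefl refl (<-≤-trans (R-right c) p))
      ... | inj₂ (_ , d) = d

      via : ∀ {P Q : Fin n → Set} {z x y d s d′} → (∀ {v} → P v → ¬ InClosedNbhd G z v) →
        (∀ {v} → Q v → ¬ InClosedNbhd G z v) → Walk (Adj G) P x d → Adj G d s → ¬ InClosedNbhd G z s →
        Adj G s d′ → Walk (Adj G) Q d′ y → PathAvoiding G z x y
      via P-far Q-far w e s-far e′ w′ = walk⇒pathAvoiding (λ far → far)
        (walk-++ (walk-∷ʳ (walk-map P-far w) e s-far) (move s-far e′ (walk-map Q-far w′)))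

      reversed : ∀ {U x y} → Walk (Adj G) U x y → Walk (Adj G) U y x
      reversed = walk-reverse (Graph.sym G)

      l<r : β l < α r
      l<r = <-≤-trans q<q′ (<⇒≤ αr)

      l→x : PathAvoiding G r l x
      l→x with left-attachment
      ... | a , (d , dd , e) , αa , βa with L-attached αa (<-≤-trans (proj₁ (walk-target dd)) (proj₁ (edge⇒overlap e)))
      ...   | d′ , ld′ , e′ = via
                (λ Lv → before⇒¬near (≤-<-trans (L-left Lv) l<r))
                (λ dv → before⇒¬near (≤-<-trans (proj₂ (walk-target dv)) αr))
                (walk-within-component ld′) e′ (before⇒¬near (≤-<-trans βa αr)) (Graph.sym G e)
                (reversed (walk-within-component dd))

      x→r : PathAvoiding G l x r
      x→r with right-attachment
      ... | b , (d , dd , e) , αb , βb with R-attached (≤-trans (proj₂ (edge⇒overlap e)) (proj₂ (walk-target dd))) βb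
      ...   | d′ , rd′ , e′ = via
                (λ dv → after⇒¬near (proj₁ (walk-target dv)))
                (λ Rv → after⇒¬near (<-≤-trans q<q′ (<⇒≤ (R-right Rv))))
                (walk-within-component dd) e (after⇒¬near αb) (Graph.sym G e′)
                (reversed (walk-within-component rd′))

      l→r : PathAvoiding G x l r
      l→r with L-attached u≤l q<βu | R-attached (≤-trans u≤l (<⇒≤ q<q′)) x<u
      ... | d , ld , e | d′ , rd′ , e′ = via
                (λ Lv → before⇒¬near (≤-<-trans (L-left Lv) l<x))
                (λ Rv → after⇒¬near (R-right Rv))
                (walk-within-component ld) e far (Graph.sym G e′)
                (reversed (walk-within-component rd′))
        where
        far : ¬ InClosedNbhd G x u
        far (inj₁ refl) = ℕ.<-irrefl refl x<u
        far (inj₂ e)    = none (x , Graph.sym G e , Vx)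

    absurd : ⊥
    absurd = at-free l x r
      ( (λ eq → before⇒¬near l<x (inj₁ eq)) , (λ eq → before⇒¬near αr (inj₁ eq)) , (λ eq → before⇒¬near l<r (inj₁ eq))
      , (λ e → before⇒¬near l<x (inj₂ (Graph.sym G e))) , (λ e → before⇒¬near αr (inj₂ (Graph.sym G e)))
      , (λ e → before⇒¬near l<r (inj₂ (Graph.sym G e)))
      , l→x , x→r , l→r )

  window : ∀ {u l x} → β l < α x → α u ≤ β l → β x < β u → ∃ λ y → Adj G u y × β l < α y × β y ≤ β x
  window {u} {l} {x} l<x u≤l x<u with any? (λ y → adj? G u y ×-dec (β l <? α y) ×-dec (β y ≤? β x))
  ... | yes found = found
  ... | no none   = ⊥-elim (Window.absurd l<x u≤l x<u none)

  open Greedy α≤β public using (rank; rank-<)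
  open Greedy α≤β hiding (rank; rank-<)

  private
    Descending : List (Fin n) → Set
    Descending = AllPairs (λ y y′ → β y′ < α y)

    star : ∀ {u} ys → Descending ys → All (Adj G u) ys → InducedStar G (length ys)
    star {u} ys desc adj = u , lookup ys , injective , (λ i → All.lookup adj (∈-lookup i)) , independent
      where
      injective : ∀ {i j} → lookup ys i ≡ lookup ys j → i ≡ j
      injective {i} {j} eq with <-cmp i j
      ... | tri< lt _ _ = ⊥-elim (before⇒¬near (allPairs-lookup desc lt) (inj₁ (≡-sym eq)))
      ... | tri≈ _ i≡j _ = i≡j
      ... | tri> _ _ lt = ⊥-elim (before⇒¬near (allPairs-lookup desc lt) (inj₁ eq))
      independent : ∀ i j → ¬ Adj G (lookup ys i) (lookup ys j)
      independent i j e with <-cmp i j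
      ... | tri< lt _ _  = before⇒¬near (allPairs-lookup desc lt) (inj₂ e)
      ... | tri≈ _ refl _ = irrefl G e
      ... | tri> _ _ lt  = before⇒¬near (allPairs-lookup desc lt) (inj₂ (Graph.sym G e))

    -- The points stabbing `u` below `i` outnumber the collected neighbours of `u` by one: there is
    -- one neighbour for each two consecutive points.
    data Progress (u : Fin n) (i : ℕ) : Set where
      none : threshold i ≤ α u → count i ≡ rank u → Progress u i
      some : α u < threshold i → ∀ ys → Descending ys → All (λ y → Adj G u y × β y < threshold i) ys →
             count i ≡ rank u + suc (length ys) → Progress u i

    progress : ∀ u {i} → α u ≤ i → i ≤ β u → Progress u i
    progress u {i} α≤i i≤β with m≤n⇒m<n∨m≡n α≤i
    ... | inj₂ refl = none (threshold-≤ i) refl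
    progress u {suc i} α≤i i<β | inj₁ (s≤s α≤i′) with progress u α≤i′ (<⇒≤ i<β) | advance i
    ... | none t c         | skip _ t′ c′ = none (≤-trans (≤-reflexive t′) t) (trans c′ c)
    ... | some t ys d a c  | skip _ t′ c′ = some (<-≤-trans t (≤-reflexive (≡-sym t′))) ys d
          (All.map (λ (e , lt) → e , <-≤-trans lt (≤-reflexive (≡-sym t′))) a) (trans c′ c)
    ... | none t c         | stab _ t′ c′ = some (<-≤-trans (s≤s α≤i′) (≤-reflexive (≡-sym t′))) [] [] []
          (trans c′ (trans (cong suc c) (ℕ.+-comm 1 _)))
    ... | some t ys d a c  | stab (x , t≤x , refl) t′ c′ with threshold-origin i
    ...   | inj₁ t≡0 = ⊥-elim (ℕ.<⇒≱ t (≤-trans (≤-reflexive t≡0) z≤n))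
    -- `l` ends at the previous stabbing point and `x` at the new one; `u` covers the window between
    -- them and so has a neighbour inside it.
    ...   | inj₂ (l , t≡l) with window (≤-trans (≤-reflexive (≡-sym t≡l)) t≤x)
                                  (≤-pred (<-≤-trans t (≤-reflexive t≡l))) i<β
    ...     | y , uy , l<y , y≤x = some (<-≤-trans (s≤s α≤i′) (≤-reflexive (≡-sym t′))) (y ∷ ys)
              (All.map (λ (_ , lt) → <-≤-trans lt (≤-trans (≤-reflexive t≡l) l<y)) a ∷ d)
              ((uy , <-≤-trans (s≤s y≤x) (≤-reflexive (≡-sym t′))) ∷
               All.map (λ (e , lt) → e , <-≤-trans lt (≤-trans (threshold-≤ i) (≤-trans (n≤1+n i) (≤-reflexive (≡-sym t′))))) a)
              (trans c′ (trans (cong suc c) (≡-sym (ℕ.+-suc _ _))))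

  -- The neighbours collected up to `α v` all end before it. Adding `v` makes up for the missing
  -- one, so the star has as many leaves as the rank increases.
  rank-edge : ∀ {p} → (∀ k → 1 ≤ k → InducedStar G k → k ≤ p) →
    ∀ {u v} → Adj G u v → rank v ≤ rank u + p
  rank-edge claws {u} {v} e with ≤-total (α u) (α v)
  ... | inj₂ v≤u = ≤-trans (count-mono v≤u) (ℕ.m≤m+n _ _)
  ... | inj₁ u≤v with progress u u≤v (proj₂ (edge⇒overlap e))
  ...   | none _ c = ≤-trans (≤-reflexive c) (ℕ.m≤m+n _ _)
  ...   | some _ ys d a c = ≤-trans (≤-reflexive c) (ℕ.+-monoʳ-≤ (rank u)
            (claws _ (s≤s z≤n) (star (v ∷ ys)
              (All.map (λ (_ , lt) → <-≤-trans lt (threshold-≤ (α v))) a ∷ d)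
              (e ∷ All.map proj₁ a))))

-- Scaling to unit cubes

-- The rational number `a / (w + 1)`; `mkℚᵘ` takes the denominator less one.
frac : ℕ → ℕ → ℚ
frac w a = fromℚᵘ (mkℚᵘ (ℤ.+ a) w)

frac-mono-≤ : ∀ w {a b} → a ≤ b → frac w a ≤ℚ frac w b
frac-mono-≤ w {a} {b} a≤b = ℚ.toℚᵘ-cancel-≤
  (ℚᵘ.≤-respˡ-≃ (ℚᵘ.≃-sym (ℚ.toℚᵘ-fromℚᵘ (mkℚᵘ (ℤ.+ a) w)))
  (ℚᵘ.≤-respʳ-≃ (ℚᵘ.≃-sym (ℚ.toℚᵘ-fromℚᵘ (mkℚᵘ (ℤ.+ b) w)))
  (*≤* (ℤ.*-monoʳ-≤-nonNeg (ℤ.+ suc w) (+≤+ a≤b)))))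

frac-cancel-≤ : ∀ w {a b} → frac w a ≤ℚ frac w b → a ≤ b
frac-cancel-≤ w {a} {b} p with
  ℚᵘ.≤-respˡ-≃ (ℚ.toℚᵘ-fromℚᵘ (mkℚᵘ (ℤ.+ a) w))
    (ℚᵘ.≤-respʳ-≃ (ℚ.toℚᵘ-fromℚᵘ (mkℚᵘ (ℤ.+ b) w)) (ℚ.toℚᵘ-mono-≤ p))
... | *≤* q with ℤ.*-cancelʳ-≤-pos (ℤ.+ a) (ℤ.+ b) (ℤ.+ suc w) q
... | +≤+ a≤b = a≤b

frac-+1 : ∀ w a → frac w a +ℚ 1ℚ ≡ frac w (suc w + a)
frac-+1 w a = ℚ.toℚᵘ-injective
  (ℚᵘ.≃-trans (ℚ.toℚᵘ-homo-+ (frac w a) 1ℚ)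
  (ℚᵘ.≃-trans (ℚᵘ.+-congˡ (toℚᵘ 1ℚ) (ℚ.toℚᵘ-fromℚᵘ (mkℚᵘ (ℤ.+ a) w)))
  (ℚᵘ.≃-trans (*≡* (cong₂ ℤ._*_ numerator denominator))
  (ℚᵘ.≃-sym (ℚ.toℚᵘ-fromℚᵘ (mkℚᵘ (ℤ.+ (suc w + a)) w))))))
  where
  numerator : (ℤ.+ a) ℤ.* (ℤ.+ 1) ℤ.+ (ℤ.+ 1) ℤ.* (ℤ.+ suc w) ≡ ℤ.+ (suc w + a)
  numerator = trans (cong₂ ℤ._+_ (ℤ.*-identityʳ (ℤ.+ a)) (ℤ.*-identityˡ (ℤ.+ suc w)))
                    (cong ℤ.+_ (ℕ.+-comm a (suc w)))
  denominator : ℤ.+ suc w ≡ ℤ.+ (suc w * 1)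
  denominator = cong ℤ.+_ (≡-sym (ℕ.*-identityʳ (suc w)))

n≤2^⌈log₂n⌉ : ∀ n → n ≤ 2 ^ ⌈log₂ n ⌉
n≤2^⌈log₂n⌉ n = go n (<-wellFounded n)
  where
  go : ∀ n (a : Acc _<_ n) → n ≤ 2 ^ ⌈log2⌉ n a
  go 0 _ = z≤n
  go 1 _ = ≤-refl
  go (suc (suc m)) (acc rs) = begin
    suc (suc m)                                   ≡⟨ cong (λ x → suc (suc x)) (≡-sym (ℕ.⌊n/2⌋+⌈n/2⌉≡n m)) ⟩
    suc (suc (⌊ m /2⌋ + ⌈ m /2⌉))                 ≤⟨ s≤s (s≤s (ℕ.+-monoˡ-≤ ⌈ m /2⌉ (ℕ.⌊n/2⌋≤⌈n/2⌉ m))) ⟩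
    suc (suc (⌈ m /2⌉ + ⌈ m /2⌉))                 ≡⟨ cong suc (≡-sym (ℕ.+-suc ⌈ m /2⌉ ⌈ m /2⌉)) ⟩
    suc ⌈ m /2⌉ + suc ⌈ m /2⌉                     ≡⟨ cong (suc ⌈ m /2⌉ +_) (≡-sym (ℕ.+-identityʳ _)) ⟩
    2 * suc ⌈ m /2⌉                               ≤⟨ ℕ.*-monoʳ-≤ 2 (go (suc ⌈ m /2⌉) (rs (ℕ.⌈n/2⌉<n m))) ⟩
    2 * 2 ^ ⌈log2⌉ (suc ⌈ m /2⌉) (rs (ℕ.⌈n/2⌉<n m)) ∎
    where open ℕ.≤-Reasoning

-- Binary digits and unit interval coordinates

parity : ℕ → ℕ
parity 0             = 0
parity 1             = 1
parity (suc (suc c)) = parity c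

parity≤1 : ∀ c → parity c ≤ 1
parity≤1 0             = z≤n
parity≤1 1             = ≤-refl
parity≤1 (suc (suc c)) = parity≤1 c

parity-< : ∀ {c c′} → c < c′ → ⌊ c /2⌋ ≡ ⌊ c′ /2⌋ → parity c ≡ 0 × parity c′ ≡ 1
parity-< {0}           {1}            _               _  = refl , refl
parity-< {1}           {1}            (s≤s ())
parity-< {suc (suc c)} {suc (suc c′)} (s≤s (s≤s lt)) eq = parity-< lt (ℕ.suc-injective eq)

half-+ : ∀ m c → ⌊ c + 2 * m /2⌋ ≡ ⌊ c /2⌋ + m
half-+ m c rewrite ℕ.+-identityʳ m | ℕ.+-comm c (m + m) | ℕ.+-comm ⌊ c /2⌋ m = go m
  where
  go : ∀ m → ⌊ m + m + c /2⌋ ≡ m + ⌊ c /2⌋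
  go zero    = refl
  go (suc m) rewrite ℕ.+-suc m m = cong suc (go m)

-- Rounding half up identifies only an odd number with its successor; after a shift by one these two
-- are told apart.
⌈/2⌉-separates : ∀ {c c′} → c < c′ → ⌈ c /2⌉ < ⌈ c′ /2⌉ ⊎ ⌈ suc c /2⌉ < ⌈ suc c′ /2⌉
⌈/2⌉-separates {0}           {suc c′}       _              = inj₁ (s≤s z≤n)
⌈/2⌉-separates {1}           {suc (suc c′)} _              = inj₂ (s≤s (s≤s z≤n))
⌈/2⌉-separates {suc (suc c)} {suc (suc c′)} (s≤s (s≤s lt)) with ⌈/2⌉-separates lt
... | inj₁ p = inj₁ (s≤s p)
... | inj₂ p = inj₂ (s≤s p)
⌈/2⌉-separates {1} {1} (s≤s ())
⌈/2⌉-separates {suc (suc c)} {1} (s≤s ())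

-- The k lowest binary digits of c, followed by c / 2ᵏ and 1 + c / 2ᵏ.
digits : ∀ k → ℕ → Fin (k + 2) → ℕ
digits zero    c zero       = c
digits zero    c (suc zero) = suc c
digits (suc k) c zero       = parity c
digits (suc k) c (suc t)    = digits k ⌊ c /2⌋ t

-- Parities never differ by more than one, and halving the numbers halves the allowed distance.
digits-close : ∀ k {c c′} → c ≤ c′ + 2 ^ k → ∀ t → digits k c t ≤ suc (digits k c′ t)
digits-close zero    {c} {c′} le zero       = ≤-trans le (≤-reflexive (ℕ.+-comm c′ 1))
digits-close zero    {c} {c′} le (suc zero) = s≤s (≤-trans le (≤-reflexive (ℕ.+-comm c′ 1)))
digits-close (suc k) {c} {c′} le zero       = ≤-trans (parity≤1 c) (s≤s z≤n)
digits-close (suc k) {c} {c′} le (suc t)    =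
  digits-close k (≤-trans (ℕ.⌊n/2⌋-mono le) (≤-reflexive (half-+ (2 ^ k) c′))) t

-- If the halves of `c` and `c′` agree, then `c` is even and `c′` odd, and the lowest digit
-- separates them; otherwise the halves are compared.
digits-separate : ∀ k {c c′} → c < c′ → ∃ λ t → ⌈ digits k c t /2⌉ < ⌈ digits k c′ t /2⌉
digits-separate zero lt with ⌈/2⌉-separates lt
... | inj₁ p = zero , p
... | inj₂ p = suc zero , p
digits-separate (suc k) {c} {c′} lt with m≤n⇒m<n∨m≡n (ℕ.⌊n/2⌋-mono (<⇒≤ lt))
... | inj₁ lt′ = let (t , p) = digits-separate k lt′ in suc t , p
... | inj₂ eq  = let (p , p′) = parity-< lt eq in
      zero , subst₂ (λ a b → ⌈ a /2⌉ < ⌈ b /2⌉) (≡-sym p) (≡-sym p′) (s≤s z≤n)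

-- ⌈ q /2⌉ * W plus b for even q, and plus a for odd q.
place : (W q a b : ℕ) → ℕ
place W 0             a b = b
place W 1             a b = W + a
place W (suc (suc q)) a b = W + place W q a b

-- The tight case is an odd `q` with `q′` one less, where the claim becomes `a ≤ b′`; elsewhere
-- `b ≤ W` leaves room.
place-close : ∀ {W a b a′ b′} q q′ → q ≤ suc q′ → a ≤ b → b ≤ W → a ≤ b′ →
  place W q a b ≤ W + place W q′ a′ b′
place-close 0 q′ _ _ b≤W _ = ≤-trans b≤W (m≤m+n _ _)
place-close {W} 1 0 _ _ _ a≤b′ = +-monoʳ-≤ W a≤b′
place-close {W} 1 1 _ a≤b b≤W _ = +-monoʳ-≤ W (≤-trans (≤-trans a≤b b≤W) (m≤m+n _ _))
place-close {W} 1 (suc (suc q′)) _ a≤b b≤W _ = +-monoʳ-≤ W (≤-trans (≤-trans a≤b b≤W) (m≤m+n _ _))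
place-close {W} 2 1 _ _ b≤W _ = +-monoʳ-≤ W (≤-trans b≤W (m≤m+n _ _))
place-close (suc (suc (suc q))) 1 (s≤s (s≤s ()))
place-close {W} (suc (suc q)) (suc (suc q′)) (s≤s (s≤s le)) a≤b b≤W a≤b′ =
  +-monoʳ-≤ W (place-close q q′ le a≤b b≤W a≤b′)
place-close (suc (suc q)) 0 (s≤s ())

≤-place : ∀ {W a b} q → a ≤ b → a ≤ place W q a b
≤-place 0             a≤b = a≤b
≤-place 1             a≤b = m≤n+m _ _
≤-place (suc (suc q)) a≤b = ≤-trans (≤-place q a≤b) (m≤n+m _ _)

-- The smallest admissible `q′` is `q + 1` for even `q`, where the claim becomes `b < a′`, and
-- `q + 2` for odd `q`, where it becomes `a < a′`. A larger `q′` only increases the distance.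
place-separate : ∀ {W a b a′ b′} q q′ → ⌈ q /2⌉ < ⌈ q′ /2⌉ → a ≤ b → a′ ≤ b′ → b < a′ →
  W + place W q a b < place W q′ a′ b′
place-separate {W} 0 1 _ _ _ b<a′ = +-monoʳ-< W b<a′
place-separate {W} 0 (suc (suc q′)) _ _ a′≤b′ b<a′ = +-monoʳ-< W (<-≤-trans b<a′ (≤-place q′ a′≤b′))
place-separate {W} 1 3 _ a≤b _ b<a′ = +-monoʳ-< W (+-monoʳ-< W (≤-<-trans a≤b b<a′))
place-separate {W} 1 (suc (suc (suc (suc q′)))) _ a≤b a′≤b′ b<a′ =
  +-monoʳ-< W (+-monoʳ-< W (<-≤-trans (≤-<-trans a≤b b<a′) (≤-place q′ a′≤b′)))
place-separate 1 1 (s≤s ())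
place-separate 1 2 (s≤s ())
place-separate (suc (suc q)) 1 (s≤s ())
place-separate {W} (suc (suc q)) (suc (suc q′)) (s≤s lt) a≤b a′≤b′ b<a′ =
  +-monoʳ-< W (place-separate q q′ lt a≤b a′≤b′ b<a′)

-- From ranked intervals to cubes

record RankedIntervals {n} (G : Graph n) (p : ℕ) (I : Fin n → Fin n → Set) : Set where
  field
    {bound}       : ℕ
    α β rank      : Fin n → ℕ
    α≤β           : ∀ v → α v ≤ β v
    β-bound       : ∀ v → β v < bound
    edge⇒overlap  : ∀ {u v} → Adj G u v → α u ≤ β v × α v ≤ β u
    overlap⇒super : ∀ {u v} → α u ≤ β v → α v ≤ β u → I u v
    rank-<        : ∀ {u v} → β u < α v → rank u < rank v
    rank-edge     : ∀ {u v} → Adj G u v → rank v ≤ rank u + p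

  module _ (k : ℕ) (p≤2ᵏ : p ≤ 2 ^ k) where

    coordinate : Fin n → Fin (k + 2) → ℕ
    -- The unit `suc bound` exceeds every interval end and is the denominator of `frac bound`.
    coordinate v t = place (suc bound) (digits k (rank v) t) (α v) (β v)

    edge⇒close : ∀ {u v} → Adj G u v → ∀ t → coordinate u t ≤ suc bound + coordinate v t
    edge⇒close {u} {v} e t = place-close (digits k (rank u) t) (digits k (rank v) t)
      (digits-close k (≤-trans (rank-edge (Graph.sym G e)) (+-monoʳ-≤ (rank v) p≤2ᵏ)) t)
      (α≤β u) (≤-trans (<⇒≤ (β-bound u)) (n≤1+n _)) (proj₁ (edge⇒overlap e))

    before⇒apart : ∀ {u v} → β u < α v → ∃ λ t → suc bound + coordinate u t < coordinate v t
    before⇒apart {u} {v} lt with digits-separate k (rank-< lt)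
    ... | t , lt′ = t , place-separate (digits k (rank u) t) (digits k (rank v) t) lt′ (α≤β u) (α≤β v) lt

    close⇒super : ∀ {u v} → (∀ t → coordinate u t ≤ suc bound + coordinate v t) →
      (∀ t → coordinate v t ≤ suc bound + coordinate u t) → I u v
    close⇒super {u} {v} uv vu with α u ≤? β v | α v ≤? β u
    ... | yes a | yes b = overlap⇒super a b
    ... | no ¬a | _     = let (t , lt) = before⇒apart (≰⇒> ¬a) in ⊥-elim (ℕ.<⇒≱ lt (uv t))
    ... | yes _ | no ¬b = let (t , lt) = before⇒apart (≰⇒> ¬b) in ⊥-elim (ℕ.<⇒≱ lt (vu t))

module _ {n : ℕ} (G : Graph n) where

  BoxOverlap : ∀ {b} → BoxRep G b → Fin b → Fin n → Fin n → Set
  BoxOverlap rep i u v = lo u i ≤ℚ hi v i × lo v i ≤ℚ hi u i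
    where open BoxRep rep

  adj⇒≢ : ∀ {u v} → Adj G u v → u ≢ v
  adj⇒≢ e refl = irrefl G e

  ranked-intervals : ATFree G → ∀ {p} → (∀ k → 1 ≤ k → InducedStar G k → k ≤ p) →
    ∀ {b} (rep : BoxRep G b) i → RankedIntervals G p (BoxOverlap rep i)
  ranked-intervals at-free claws rep i = record
    { α = α ; β = β ; rank = rank ; α≤β = α≤β ; β-bound = β-bound
    ; edge⇒overlap = edge⇒overlap ; overlap⇒super = overlap⇒super
    ; rank-< = rank-< ; rank-edge = rank-edge claws }
    where
    open BoxRep rep
    triangulation = minimal-triangulation (adj? G)
      (λ u v → (lo u i ℚ.≤? hi v i) ×-dec (lo v i ℚ.≤? hi u i))
      (λ v → lo≤hi v i , lo≤hi v i) (λ (p , q) → q , p)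
      (overlap-chordal {lo = λ v → lo v i} {hi = λ v → hi v i} (λ v → lo≤hi v i))
      (λ {u} {v} e → Equivalence.to (correct u v (adj⇒≢ e)) e i)
    open ClawBound G triangulation at-free (Triangulated.cliquePath G triangulation at-free)

  cubeRep : ∀ {b p} k → p ≤ 2 ^ k → (rep : BoxRep G b) →
    (∀ i → RankedIntervals G p (BoxOverlap rep i)) → CubeRep G (b * (k + 2))
  cubeRep {b} k p≤2ᵏ rep intervals = record
    { lo = λ v j → let (i , t) = remQuot {b} (k + 2) j in
        frac (bound i) (coordinate i v t)
    ; correct = λ u v u≢v → mk⇔
        (λ e j → let (i , t) = remQuot {b} (k + 2) j in
           close i (edge⇒close i e t) , close i (edge⇒close i (Graph.sym G e) t))
        (λ near → Equivalence.from (BoxRep.correct rep u v u≢v) λ i → close⇒super i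
           (λ t → apart i (proj₁ (at u v near i t)))
           (λ t → apart i (proj₂ (at u v near i t))))
    }
    where
    bound : Fin b → ℕ
    bound i = RankedIntervals.bound (intervals i)
    coordinate = λ i → RankedIntervals.coordinate (intervals i) k p≤2ᵏ
    edge⇒close = λ i {u} {v} → RankedIntervals.edge⇒close (intervals i) k p≤2ᵏ {u} {v}
    close⇒super = λ i {u} {v} → RankedIntervals.close⇒super (intervals i) k p≤2ᵏ {u} {v}
    Near : Fin n → Fin n → Fin b × Fin (k + 2) → Set
    Near u v (i , t) =
      frac (bound i) (coordinate i u t) ≤ℚ frac (bound i) (coordinate i v t) +ℚ 1ℚ ×
      frac (bound i) (coordinate i v t) ≤ℚ frac (bound i) (coordinate i u t) +ℚ 1ℚ
    at : ∀ u v → (∀ j → Near u v (remQuot {b} (k + 2) j)) → ∀ i t → Near u v (i , t)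
    at u v near i t = subst (Near u v) (remQuot-combine i t) (near (combine i t))
    close : ∀ i {x y} → x ≤ suc (bound i) + y → frac (bound i) x ≤ℚ frac (bound i) y +ℚ 1ℚ
    close i {x} {y} le = subst (frac (bound i) x ≤ℚ_) (≡-sym (frac-+1 (bound i) y)) (frac-mono-≤ (bound i) le)
    apart : ∀ i {x y} → frac (bound i) x ≤ℚ frac (bound i) y +ℚ 1ℚ → x ≤ suc (bound i) + y
    apart i {x} {y} le = frac-cancel-≤ (bound i) (subst (frac (bound i) x ≤ℚ_) (frac-+1 (bound i) y) le)

-- Boxicity and colourings

-- The ends of [a , b] scaled by two; unless P holds, the interval is widened
-- by one on each side.  Everything is shifted by one to stay within ℕ.
module _ {P : Set} where

  low high : Dec P → ℕ → ℕ
  low  (yes _) a = suc (a + a)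
  low  (no _)  a = a + a
  high (yes _) b = suc (b + b)
  high (no _)  b = suc (suc (b + b))

  low-≤ : ∀ d {a} → low d a ≤ suc (a + a)
  low-≤ (yes _) = ≤-refl
  low-≤ (no _)  = n≤1+n _

  ≤-low : ∀ d {a} → a + a ≤ low d a
  ≤-low (yes _) = n≤1+n _
  ≤-low (no _)  = ≤-refl

  high-≤ : ∀ d {b} → high d b ≤ suc (suc (b + b))
  high-≤ (yes _) = n≤1+n _
  high-≤ (no _)  = ≤-refl

  ≤-high : ∀ d {b} → suc (b + b) ≤ high d b
  ≤-high (yes _) = ≤-refl
  ≤-high (no _)  = n≤1+n _

  low-yes : ∀ d {a} → P → low d a ≡ suc (a + a)
  low-yes (yes _) _ = refl
  low-yes (no ¬p) p = ⊥-elim (¬p p)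

  high-yes : ∀ d {b} → P → high d b ≡ suc (b + b)
  high-yes (yes _) _ = refl
  high-yes (no ¬p) p = ⊥-elim (¬p p)

double-mono : ∀ {a b} → a ≤ b → a + a ≤ b + b
double-mono le = ℕ.+-mono-≤ le le

double-< : ∀ {a b} → a < b → suc (suc (a + a)) ≤ b + b
double-< {a} {b} lt = ≤-trans (≤-reflexive (cong suc (≡-sym (ℕ.+-suc a a)))) (double-mono lt)

module IndependentSet {n : ℕ} (G : Graph n) (at-free : ATFree G) (S : Subset n)
  (independent : ∀ {u v} → u Subset.∈ S → v Subset.∈ S → ¬ Adj G u v)
  (dominating : ∀ {v} → (∀ {s} → s Subset.∈ S → ¬ Adj G s v) → v Subset.∈ S) where

  private
    near? : ∀ z v → Dec (InClosedNbhd G z v)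
    near? z v = (v ≟ z) ⊎-dec adj? G z v

    member? : ∀ v → Dec (v Subset.∈ S)
    member? = Subset._∈? S

    members : List (Fin n)
    members = filter member? (allFin n)

    vertex : Fin (length members) → Fin n
    vertex = lookup members

    vertex-∈ : ∀ i → vertex i Subset.∈ S
    vertex-∈ i = proj₂ (∈-filter⁻ member? {xs = allFin n} (∈-lookup i))

    Far : Fin n → Fin n → Set
    Far z v = ¬ InClosedNbhd G z v

    -- Indices of members are related instead of vertices because `through` relies on membership in
    -- `S`.
    Linked : (b a c : Fin (length members)) → Set
    Linked b a c = Walk (Adj G) (Far (vertex b)) (vertex a) (vertex c)

    -- `v` tells `s` and `s′` apart, and members of `S` are never adjacent.
    far-member : ∀ {s s′ v} → s Subset.∈ S → s′ Subset.∈ S → InClosedNbhd G s v → Far s′ v → Far s′ s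
    far-member s∈ s′∈ near far (inj₁ refl) = far near
    far-member s∈ s′∈ near far (inj₂ e)    = independent s′∈ s∈ e

    towards : ∀ {U s v} → U s → U v → InClosedNbhd G s v → Walk (Adj G) U s v
    towards us uv (inj₁ refl) = stay us
    towards us uv (inj₂ e)    = move us e (stay uv)

    linked-asteroidalFree : AsteroidalFree Linked
    linked-asteroidalFree = record
      { connected?    = λ b a c → walk? (adj? G) (λ v → ¬? (near? (vertex b) v)) (vertex a) (vertex c)
      ; symmetric     = walk-reverse (Graph.sym G)
      ; transitive    = walk-++
      ; removed       = λ w → walk-source w (inj₁ refl)
      ; through       = through
      ; no-asteroidal = λ {a} {b} {c} la lb lc → at-free (vertex a) (vertex b) (vertex c)
          ( (λ eq → walk-source la (inj₁ (≡-sym eq))) , (λ eq → walk-target lb (inj₁ (≡-sym eq)))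
          , (λ eq → walk-target la (inj₁ (≡-sym eq)))
          , (λ e → walk-source la (inj₂ e)) , (λ e → walk-target lb (inj₂ e)) , (λ e → walk-target la (inj₂ e))
          , walk⇒pathAvoiding (λ far → far) lc , walk⇒pathAvoiding (λ far → far) la
          , walk⇒pathAvoiding (λ far → far) lb )
      }
      where
      through : ∀ {a c e} b → Linked a e c → Linked b e c ⊎ Linked a e b
      through {a} b w with walk-avoids-or-meets (near? (vertex b)) w
      ... | inj₁ w′              = inj₁ (walk-map proj₂ w′)
      ... | inj₂ (z , near , w′) = inj₂ (walk-++ w′ (walk-reverse (Graph.sym G)
              (towards (far-member (vertex-∈ b) (vertex-∈ a) near (walk-target w′)) (walk-target w′) near)))

    open LinearOrder _≟_ linked-asteroidalFree
    order = linear-order (allFin (length members))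
    path = proj₁ order

    s : Fin (length path) → Fin n
    s j = vertex (lookup path j)

    s-∈ : ∀ j → s j Subset.∈ S
    s-∈ j = vertex-∈ (lookup path j)

    position : ∀ {v} → v Subset.∈ S → ∃ λ j → s j ≡ v
    position {v} v∈ = index i∈ , trans (cong vertex (≡-sym (lookup-index i∈))) (≡-sym (lookup-index v∈members))
      where
      v∈members = ∈-filter⁺ member? (∈-allFin v) v∈
      i∈ = proj₁ (proj₂ order) (∈-allFin (index v∈members))

    inhabited : ∀ v → ∃ λ j → InClosedNbhd G (s j) v
    inhabited v with member? v
    ... | yes v∈ = let (j , eq) = position v∈ in j , inj₁ (≡-sym eq)
    ... | no v∉ with any? (λ j → near? (s j) v)
    ...   | yes found = found
    ...   | no none   = ⊥-elim (v∉ (dominating λ u∈ e →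
              let (j , eq) = position u∈ in none (j , inj₂ (subst (λ u → Adj G u v) (≡-sym eq) e))))

    -- The walk from `s i` through `v` and `w` to `s l` would avoid the closed neighbourhood of
    -- `s j`, against the order.
    separates : ∀ {i j l v w} → toℕ i < toℕ j → toℕ j < toℕ l →
      InClosedNbhd G (s i) v → InClosedNbhd G (s l) w → v ≡ w ⊎ Adj G v w →
      Far (s j) v → Far (s j) w → ⊥
    separates {i} {j} {l} {v} {w} i<j j<l iv lw vw jv jw = ordered-lookup (proj₂ (proj₂ order)) i<j j<l
      (walk-++ (towards (far-member (s-∈ i) (s-∈ j) iv jv) jv iv)
      (walk-++ (middle vw)
        (walk-reverse (Graph.sym G) (towards (far-member (s-∈ l) (s-∈ j) lw jw) jw lw))))
      where
      middle : v ≡ w ⊎ Adj G v w → Walk (Adj G) (Far (s j)) v w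
      middle (inj₁ refl) = stay jv
      middle (inj₂ e)    = move jv e (stay jw)

    convex : ∀ {i j l v} → toℕ i < toℕ j → toℕ j < toℕ l →
      InClosedNbhd G (s i) v → InClosedNbhd G (s l) v → InClosedNbhd G (s j) v
    convex {j = j} {v = v} i<j j<l iv lv = decidable-stable (near? (s j) v) λ jv →
      separates i<j j<l iv lv (inj₁ refl) jv jv

    open Span (λ j → near? (s j)) inhabited convex

    α β : Fin n → ℕ
    α v = toℕ (first v)
    β v = toℕ (last v)

    shares : ∀ {u v} → u Subset.∈ S → Adj G u v → α u ≤ β v × α v ≤ β u
    shares {u} {v} u∈ e with position u∈
    ... | j , refl = ≤-trans (first-≤ (inj₁ refl)) (≤-last (inj₂ e)) , ≤-trans (first-≤ (inj₂ e)) (≤-last (inj₁ refl))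

    -- The edge cannot bridge a position that both of its ends miss. A gap without such a position
    -- remains possible, and the widening of intervals of vertices outside `S` closes it.
    adjacent-gap : ∀ {u v} → Adj G u v → α u ≤ suc (β v)
    adjacent-gap {u} {v} e = ℕ.≮⇒≥ λ gap →
      let j< = ≤-trans gap (<⇒≤ (toℕ<n (first u)))
          j = fromℕ< j<
          j≡ = toℕ-fromℕ< j<
          v<j = ≤-reflexive (≡-sym j≡)
          j<u = ≤-trans (≤-reflexive (cong suc j≡)) gap
      in separates v<j j<u (last-∈ v) (first-∈ u) (inj₂ (Graph.sym G e))
           (λ jv → ℕ.<⇒≱ v<j (≤-last jv)) (λ ju → ℕ.<⇒≱ j<u (first-≤ ju))

    -- The only member of `S` in the closed neighbourhood of `u` is `u`, so a shared position would
    -- make `v` equal or adjacent to `u`.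
    disjoint : ∀ {u v} → u Subset.∈ S → u ≢ v → ¬ Adj G u v → β u < α v ⊎ β v < α u
    disjoint {u} {v} u∈ u≢v ¬e with α v ≤? β u | α u ≤? β v
    ... | no ¬p | _     = inj₁ (≰⇒> ¬p)
    ... | yes _ | no ¬q = inj₂ (≰⇒> ¬q)
    ... | yes p | yes q = ⊥-elim (common (≤-total (α u) (α v)))
      where
      clash : ∀ {j} → InClosedNbhd G (s j) u → InClosedNbhd G (s j) v → ⊥
      clash (inj₁ refl) (inj₁ refl) = u≢v refl
      clash (inj₁ refl) (inj₂ e)    = ¬e e
      clash {j} (inj₂ e) _          = independent (s-∈ j) u∈ e
      common : α u ≤ α v ⊎ α v ≤ α u → ⊥
      common (inj₁ r) = clash (span-∈ r p) (first-∈ v)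
      common (inj₂ r) = clash (first-∈ u) (span-∈ r q)

  lo hi : Fin n → ℕ
  lo v = low (member? v) (α v)
  hi v = high (member? v) (β v)

  private
    meeting : ∀ u v → α u ≤ β v → lo u ≤ hi v
    meeting u v le = ≤-trans (low-≤ (member? u)) (≤-trans (s≤s (double-mono le)) (≤-high (member? v)))

  lo≤hi : ∀ v → lo v ≤ hi v
  lo≤hi v = meeting v v (first≤last v)

  edge⇒lo≤hi : ∀ {u v} → Adj G u v → lo u ≤ hi v
  edge⇒lo≤hi {u} {v} e = go (member? u) (member? v)
    where
    go : (u∈? : Dec (u Subset.∈ S)) (v∈? : Dec (v Subset.∈ S)) → low u∈? (α u) ≤ high v∈? (β v)
    go (yes u∈) (yes v∈) = ⊥-elim (independent u∈ v∈ e)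
    go (yes u∈) (no _)   = ≤-trans (s≤s (double-mono (proj₁ (shares u∈ e)))) (n≤1+n _)
    go (no _)   (yes v∈) = ≤-trans (double-mono (proj₂ (shares v∈ (Graph.sym G e)))) (n≤1+n _)
    go (no _)   (no _)   = ≤-trans (double-mono (adjacent-gap e)) (≤-reflexive (cong suc (ℕ.+-suc _ _)))

  -- The interval of `u` is not widened. Doubling turns a step of one between the ends into two, and
  -- widening the interval of `v` takes back at most one.
  nonedge-separated : ∀ {u v} → u Subset.∈ S → u ≢ v → ¬ Adj G u v → ¬ (lo u ≤ hi v × lo v ≤ hi u)
  nonedge-separated {u} {v} u∈ u≢v ¬e (p , q) with disjoint u∈ u≢v ¬e
  ... | inj₁ u<v = ℕ.<⇒≱ (≤-trans (double-< u<v) (≤-low (member? v))) (≤-trans q (≤-reflexive (high-yes (member? u) u∈)))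
  ... | inj₂ v<u = ℕ.<⇒≱ (s≤s (double-< v<u))
          (≤-trans (≤-reflexive (≡-sym (low-yes (member? u) u∈))) (≤-trans p (high-≤ (member? v))))

boxRep-of-colouring : ∀ {n} (G : Graph n) → ATFree G → ∀ {c} → ProperColouring G c → BoxRep G c
boxRep-of-colouring {n} G at-free {c} (colour , proper) = record
  { lo = λ v i → frac 0 (lo i v)
  ; hi = λ v i → frac 0 (hi i v)
  ; lo≤hi = λ v i → frac-mono-≤ 0 (Class.lo≤hi i v)
  ; correct = λ u v u≢v → mk⇔
      (λ e i → frac-mono-≤ 0 (Class.edge⇒lo≤hi i e) , frac-mono-≤ 0 (Class.edge⇒lo≤hi i (Graph.sym G e)))
      (λ meet → decidable-stable (adj? G u v) λ ¬e →
        let (p , q) = meet (colour u) in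
        Class.nonedge-separated (colour u) (class-∈ u) u≢v ¬e (frac-cancel-≤ 0 p , frac-cancel-≤ 0 q))
  }
  where
  -- Cliques of non-adjacency are independent sets, so `extend` enlarges a colour class to a maximal
  -- one; its maximality is the domination that `IndependentSet` asks for.
  open MaximalCliques {H = λ u v → ¬ Adj G u v} (λ u v → ¬? (adj? G u v)) (irrefl G) (λ ¬e e → ¬e (Graph.sym G e))
  same? : ∀ i v → Dec (colour v ≡ i)
  same? i v = colour v ≟ i
  maximal : ∀ i → ∃ λ S → MaximalClique (Subset._∈ S) × subsetOf (same? i) Subset.⊆ S
  maximal i = extend (subsetOf (same? i)) λ {u} {v} u∈ v∈ e →
    proper u v e (trans (∈-subsetOf⁻ (same? i) u∈) (≡-sym (∈-subsetOf⁻ (same? i) v∈)))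
  module Class (i : Fin c) = IndependentSet G at-free (proj₁ (maximal i))
    (proj₁ (proj₁ (proj₂ (maximal i)))) (proj₂ (proj₁ (proj₂ (maximal i))))
  lo hi : Fin c → Fin n → ℕ
  lo i = Class.lo i
  hi i = Class.hi i
  class-∈ : ∀ u → u Subset.∈ proj₁ (maximal (colour u))
  class-∈ u = proj₂ (proj₂ (maximal (colour u))) (∈-subsetOf⁺ (same? (colour u)) refl)

theorem12 : ∀ {n} (G : Graph n) → ATFree G →
    ∀ b c p → IsBoxicity G b → IsChromaticNumber G c → IsClawNumber G p →
    CubicityAtMost G (b * (⌈log₂ p ⌉ + 2)) × b * (⌈log₂ p ⌉ + 2) ≤ c * (⌈log₂ p ⌉ + 2)
theorem12 G at-free b c p (rep , least-box) (colouring , _) (_ , _ , claws) =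
  (b * (⌈log₂ p ⌉ + 2) , ≤-refl ,
    cubeRep G ⌈log₂ p ⌉ (n≤2^⌈log₂n⌉ p) rep (ranked-intervals G at-free claws rep)) ,
  ℕ.*-monoˡ-≤ (⌈log₂ p ⌉ + 2) (least-box c (boxRep-of-colouring G at-free colouring))
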